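{- Let $k\geq 3$, $t\geq s\geq 1$ and $\beta\geq 0$ be fixed integers, and let $n$ be sufficiently large (depending on $s,t,k,\beta$). Put $m=\lfloor (s+\beta)k/(\beta+1)\rfloor$ and $\hat\beta=\hat\beta(k,s,\beta)$. Let $\mathcal{F}\subseteq\binom{[n]}{k}$ be an $(s,t)$-union intersecting family with $\ell(\mathcal{F})\geq s+\beta$. Then $$|\mathcal{F}|\leq \binom{n-1}{k-1}-\binom{n-m-1}{k-1}+s+t+\hat\beta-1.$$ Equality holds if and only if there exist pairwise distinct $k$-sets $A_1,\ldots,A_{s+\hat\beta},F_1,\ldots,F_{t-1}$ such that (1) $1\notin\bigcup_{i=1}^{s+\hat\beta}A_i$; (2) $|T(A_1,\ldots,A_{s+\hat\beta}:s)|=m$; (3) for each $i\leq t-1$, $F_i\in \mathcal{S}_1\setminus \mathcal{S}_1(A_1,\ldots,A_{s+\hat\beta}:s)$; (4) the family $\{A_1,\ldots,A_{s+\hat\beta},F_1,\ldots,F_{t-1}\}$ is $(s,t)$-union intersecting; and $\mathcal{F}$ is isomorphic to $\mathcal{S}_1(A_1,\ldots,A_{s+\hat\beta}:s)\cup\{A_1,\ldots,A_{s+\hat\beta}\}\cup\{F_1,\ldots,F_{t-1}\}$.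
   Context: $[n]=\{1,\ldots,n\}$ and $\binom{[n]}{k}$ is the family of $k$-subsets of $[n]$. A family is intersecting if any two of its members meet. For $s,t\ge1$, a family $\mathcal{F}\subseteq\binom{[n]}{k}$ is $(s,t)$-union intersecting if for any pairwise distinct $A_1,\ldots,A_{s+t}\in\mathcal{F}$, $(\bigcup_{i=1}^s A_i)\cap(\bigcup_{i=1}^t A_{s+i})\neq\varnothing$. $\ell(\mathcal{F})$ is the minimum number of members of $\mathcal{F}$ whose removal leaves an intersecting family. $\mathcal{S}_1=\{A\in\binom{[n]}{k}:1\in A\}$. For $k$-sets $A_1,\ldots,A_p$ ($p\ge s$) not containing $1$: $\mathcal{S}_1(A_1,\ldots,A_p:s)$ is the family of all $A\in\mathcal{S}_1$ that are disjoint from at most $s-1$ of the $A_i$; and $T(A_1,\ldots,A_p:s)$ is the set of elements $x$ lying in at least $p-s+1$ of the sets $A_1,\ldots,A_p$ (i.e. in $A_{i_1}\cap\cdots\cap A_{i_{p-s+1}}$ for some distinct indices). For nonnegative integers $k,s,\beta$ with $s\ge1$: if $\lfloor (s+\beta)k/(\beta+1)\rfloor>k$, $\hat\beta(k,s,\beta)$ is the largest positive integer $b$ with $\lfloor (s+b)k/(b+1)\rfloor=\lfloor (s+\beta)k/(\beta+1)\rfloor$; if $\lfloor (s+\beta)k/(\beta+1)\rfloor=k$, $\hat\beta(k,s,\beta)=\beta$. Two families are isomorphic if some permutation of $[n]$ maps one onto the other.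
   Formalization: When m>k, β̂ is taken as the largest nonnegative (not positive) integer b attaining the value m; for β=0 and s≥2 no positive b attains m=sk, so β̂ would be undefined, and it is 0 here; otherwise the two definitions agree. -}

module Defs where

open import Data.Nat using (ℕ; zero; suc; _+_; _*_; _∸_; _≤_; _<_; _≤ᵇ_; _≡ᵇ_)
open import Data.Nat.DivMod using (_/_)
open import Data.Bool using (Bool; true; false; if_then_else_)
open import Data.Fin using (Fin; zero; suc; _↑ˡ_; _↑ʳ_)
open import Data.Fin.Subset using (Subset; _∩_; ⋃; ∣_∣; Nonempty)
open import Data.Fin.Permutation using (Permutation′; _⟨$⟩ˡ_)
open import Data.Vec using (lookup; tabulate)
import Data.List as L
open import Data.List using (List)
open import Data.List.Membership.Propositional using (_∈_)
open import Data.List.Relation.Unary.Unique.Propositional using (Unique)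
open import Data.List.Relation.Unary.All using (All)
open import Data.Product using (Σ; _×_; ∃)
open import Data.Sum using (_⊎_)
open import Function using (_∘_)
open import Function.Definitions using (Injective)
open import Relation.Binary.PropositionalEquality using (_≡_)
open import Relation.Nullary using (¬_)
open import Data.Nat.Combinatorics using (_C_)

record Family (n : ℕ) : Set where
  constructor mkFamily
  field
    members : List (Subset n)
    unique  : Unique members

open Family public

Uniform : ∀ {n} → ℕ → List (Subset n) → Set
Uniform k F = All (λ A → ∣ A ∣ ≡ k) F

Intersecting : ∀ {n} → List (Subset n) → Set
Intersecting F = ∀ {A B} → A ∈ F → B ∈ F → Nonempty (A ∩ B)

bigUnion : ∀ {n p} → (Fin p → Subset n) → Subset n
bigUnion a = ⋃ (L.tabulate a)

UnionIntersecting : ∀ {n} → ℕ → ℕ → List (Subset n) → Set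
UnionIntersecting s t F =
  (c : Fin (s + t) → Subset _) → Injective _≡_ _≡_ c → (∀ i → c i ∈ F) →
  Nonempty (bigUnion (λ (i : Fin s) → c (i ↑ˡ t)) ∩ bigUnion (λ (j : Fin t) → c (s ↑ʳ j)))

-- ℓ(F) ≥ r : removing fewer than r members never leaves an intersecting family,
-- i.e. every intersecting subfamily G ⊆ F satisfies |F| - |G| ≥ r.
ℓ≥ : ∀ {n} → List (Subset n) → ℕ → Set
ℓ≥ F r = (G : List (Subset _)) → Unique G → All (_∈ F) G → Intersecting G →
  L.length G + r ≤ L.length F

countTrue : ∀ {p} → (Fin p → Bool) → ℕ
countTrue {zero} f = 0
countTrue {suc p} f = (if f zero then 1 else 0) + countTrue (f ∘ suc)

disjointCount : ∀ {n p} → Subset n → (Fin p → Subset n) → ℕ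
disjointCount A a = countTrue (λ i → ∣ A ∩ a i ∣ ≡ᵇ 0)

-- the element 1 of [n] (ground set Fin (suc n) represents [suc n])
one : ∀ {n} → Fin (suc n)
one = zero

InS1 : ∀ {n} → ℕ → Subset (suc n) → Set
InS1 k A = ∣ A ∣ ≡ k × lookup A one ≡ true

InS1A : ∀ {n p} → ℕ → (Fin p → Subset (suc n)) → ℕ → Subset (suc n) → Set
InS1A k a s A = InS1 k A × disjointCount A a < s

T : ∀ {n p} → (Fin p → Subset n) → ℕ → Subset n
T {p = p} a s = tabulate (λ x → (p ∸ s + 1) ≤ᵇ countTrue (λ i → lookup (a i) x))

mfun : ℕ → ℕ → ℕ → ℕ
mfun k s b = ((s + b) * k) / suc b

IsBetaHat : ℕ → ℕ → ℕ → ℕ → Set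
IsBetaHat k s β b =
  (k < mfun k s β → mfun k s b ≡ mfun k s β × (∀ b' → mfun k s b' ≡ mfun k s β → b' ≤ b))
  × (mfun k s β ≡ k → b ≡ β)

image : ∀ {n} → Permutation′ n → Subset n → Subset n
image σ B = tabulate (λ y → lookup B (σ ⟨$⟩ˡ y))

bound : ℕ → ℕ → ℕ → ℕ → ℕ → ℕ → ℕ
bound N k m s t b = ((N ∸ 1) C (k ∸ 1) ∸ (N ∸ m ∸ 1) C (k ∸ 1)) + s + t + b ∸ 1

-- The equality characterisation, with p = s + β̂ and m = ⌊(s+β)k/(β+1)⌋.
-- c lists the pairwise distinct k-sets A_1,...,A_p,F_1,...,F_{t-1}.
module _ {n : ℕ} (k s t m p : ℕ) (c : Fin (p + (t ∸ 1)) → Subset (suc n)) where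
  Aset : Fin p → Subset (suc n)
  Aset i = c (i ↑ˡ (t ∸ 1))

  Fset : Fin (t ∸ 1) → Subset (suc n)
  Fset j = c (p ↑ʳ j)

  InExtremal : Subset (suc n) → Set
  InExtremal B = InS1A k Aset s B ⊎ (∃ λ i → B ≡ Aset i) ⊎ (∃ λ j → B ≡ Fset j)

  ExtremalData : List (Subset (suc n)) → Set
  ExtremalData F =
    Injective _≡_ _≡_ c
    × (∀ i → ∣ c i ∣ ≡ k)
    × (∀ i → lookup (Aset i) one ≡ false)
    × ∣ T Aset s ∣ ≡ m
    × (∀ j → InS1 k (Fset j) × ¬ InS1A k Aset s (Fset j))
    × UnionIntersecting s t (L.tabulate c)
    × (Σ (Permutation′ (suc n)) λ σ →
         ∀ B → (B ∈ F → InExtremal (image σ B)) × (InExtremal (image σ B) → B ∈ F))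

IsExtremal : ∀ {n} → (k s t m p : ℕ) → List (Subset (suc n)) → Set
IsExtremal {n} k s t m p F =
  Σ (Fin (p + (t ∸ 1)) → Subset (suc n)) λ c → ExtremalData k s t m p c F

{-# OPTIONS --safe #-}

-- The union of any s members has at most sk points and is missed by fewer than t members. Hence a pair
-- of points is missed by fewer than s members as soon as its degree exceeds a constant times
-- W = C(n, k-3); call such a pair heavy. Every point is missed by at least s members because
-- ℓ(F) ≥ s + β, so applying the first remark twice shows that all but O(W) members contain a heavy pair.
-- Two heavy pairs always meet, so they form a star or a triangle. Fewer than m pairs cannot carry
-- |F| for large n, which excludes the triangle and leaves a star with centre 1 and a set S of at least
-- m leaves.
--
-- Let A_1, …, A_{s+b} be the members avoiding 1. Each point of S lies in at least b+1 of them, so counting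
-- incidences gives |S| = m = ⌊(s+b)k/(b+1)⌋ and leaves at most b incidences outside S. Therefore
-- S = T(A_1, …, A_{s+b} : s), the family S_1(A_1, …, A_{s+b} : s) consists of the k-sets through 1 meeting S,
-- and at least s of the A_i lie inside S, which allows at most t-1 members through 1 that miss S.
-- Finally b ≤ β̂, and equality in the bound forces equality in each of these estimates.

module Submission where

open import Defs
open import Data.Bool using (Bool; true; false; if_then_else_)
import Data.Bool
import Data.Bool.Properties as Bool
open import Data.Fin using (Fin; zero; suc; _↑ˡ_; _↑ʳ_; splitAt)
import Data.Fin.Properties as Fin
open import Data.Fin.Permutation using (Permutation′; _⟨$⟩ˡ_; _⟨$⟩ʳ_; flip; inverseˡ; inverseʳ; transpose; _∘ₚ_)
import Data.Fin.Permutation as Perm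
open import Data.Fin.Subset using (Subset; _∈_; _∉_; _⊆_; _∩_; _∪_; ∁; ⁅_⁆; ∣_∣; Nonempty) renaming (⊤ to full)
open import Data.Fin.Subset.Properties
open import Data.List using (List; []; _∷_; _++_; length; map; filter; tabulate; allFin; take; lookup)
import Data.List.Properties as List
import Data.List.Membership.Propositional as Mem
open Mem using () renaming (_∈_ to _∈ₗ_)
import Data.List.Membership.Propositional.Properties as Mem
import Data.List.Membership.DecPropositional as DecMem
open import Data.List.Relation.Binary.Disjoint.Propositional using (Disjoint)
open import Data.List.Relation.Unary.All as All using (All; []; _∷_)
import Data.List.Relation.Unary.All.Properties as All
open import Data.List.Relation.Unary.AllPairs using ([]; _∷_)
open import Data.List.Relation.Unary.Any using (here; there)
open import Data.List.Relation.Unary.Unique.Propositional using (Unique)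
import Data.List.Relation.Unary.Unique.Propositional.Properties as Unique
open import Data.Nat hiding (_/_)
open import Data.Nat.Combinatorics using (_C_; nCk+nC[k+1]≡[n+1]C[k+1]; k>n⇒nCk≡0; nCk≡nC[n∸k]; nCn≡1; nC1≡n)
open import Data.Nat.DivMod using (m/n*n≤m; /-monoˡ-≤; m*n/n≡m)
open import Data.Nat.Properties
open import Data.Nat.Tactic.RingSolver using (solve-∀)
open import Data.Product using (Σ; ∃-syntax; _×_; _,_; proj₁; proj₂)
open import Data.Sum using (_⊎_; inj₁; inj₂; [_,_]′)
open import Data.Vec using ([]; _∷_; here; there) renaming (lookup to lookupᵥ; tabulate to tabulateᵥ)
import Data.Vec.Properties as Vec
open import Function using (_∘_; id; case_of_)
open import Function.Definitions using (Injective)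
open import Level using (Level; 0ℓ)
open import Relation.Binary.PropositionalEquality using (_≡_; _≢_; refl; sym; trans; cong; cong₂; subst; subst₂; module ≡-Reasoning)
open import Relation.Nullary using (¬_; Dec; yes; no; does; contradiction)
open import Relation.Nullary.Decidable using (_×-dec_; _⊎-dec_; ¬?; decidable-stable; dec-true)
open import Relation.Unary using (Pred; Decidable)

private variable
  ℓ : Level
  A B : Set ℓ
  P Q R : Pred A ℓ
  n : ℕ

-- Sums and counting over lists

ind : Dec A → ℕ
ind d = if does d then 1 else 0

∑ : List A → (A → ℕ) → ℕ
∑ []       f = 0
∑ (x ∷ xs) f = f x + ∑ xs f

-- Counting by a sum of indicators turns double counting into `∑-swap`.
# : {A : Set ℓ} {P : Pred A ℓ} → Decidable P → List A → ℕ
# P? xs = ∑ xs (λ x → ind (P? x))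

ind-yes : (d : Dec A) → A → ind d ≡ 1
ind-yes (yes _) _ = refl
ind-yes (no ¬p) p = contradiction p ¬p

ind-no : (d : Dec A) → ¬ A → ind d ≡ 0
ind-no (yes p) ¬p = contradiction p ¬p
ind-no (no _)  _  = refl

ind-≤ : (d : Dec A) {m : ℕ} → (A → 1 ≤ m) → ind d ≤ m
ind-≤ (yes p) f = f p
ind-≤ (no _)  f = z≤n

∑-mono : ∀ (xs : List A) {f g} → (∀ {x} → x ∈ₗ xs → f x ≤ g x) → ∑ xs f ≤ ∑ xs g
∑-mono []       h = z≤n
∑-mono (x ∷ xs) h = +-mono-≤ (h (here refl)) (∑-mono xs (h ∘ there))

∑-cong : ∀ (xs : List A) {f g} → (∀ {x} → x ∈ₗ xs → f x ≡ g x) → ∑ xs f ≡ ∑ xs g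
∑-cong []       h = refl
∑-cong (x ∷ xs) h = cong₂ _+_ (h (here refl)) (∑-cong xs (h ∘ there))

∑-const : ∀ (xs : List A) c → ∑ xs (λ _ → c) ≡ length xs * c
∑-const []       c = refl
∑-const (x ∷ xs) c = cong (c +_) (∑-const xs c)

∑-distrib-+ : ∀ (xs : List A) f g → ∑ xs (λ x → f x + g x) ≡ ∑ xs f + ∑ xs g
∑-distrib-+ []       f g = refl
∑-distrib-+ (x ∷ xs) f g =
  trans (cong ((f x + g x) +_) (∑-distrib-+ xs f g)) (interchange (f x) (g x) (∑ xs f) (∑ xs g))
  where
  interchange : ∀ a b c d → (a + b) + (c + d) ≡ (a + c) + (b + d)
  interchange = solve-∀

∑-distribʳ-* : ∀ (xs : List A) f c → ∑ xs (λ x → f x * c) ≡ ∑ xs f * c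
∑-distribʳ-* []       f c = refl
∑-distribʳ-* (x ∷ xs) f c =
  trans (cong (f x * c +_) (∑-distribʳ-* xs f c)) (sym (*-distribʳ-+ c (f x) _))

∑-swap : ∀ (xs : List A) (ys : List B) (f : A → B → ℕ) →
         ∑ xs (λ x → ∑ ys (f x)) ≡ ∑ ys (λ y → ∑ xs (λ x → f x y))
∑-swap []       ys f = sym (trans (∑-const ys 0) (*-zeroʳ (length ys)))
∑-swap (x ∷ xs) ys f =
  trans (cong (∑ ys (f x) +_) (∑-swap xs ys f)) (sym (∑-distrib-+ ys (f x) _))

∑-map : ∀ (g : B → A) (ys : List B) (f : A → ℕ) → ∑ (map g ys) f ≡ ∑ ys (f ∘ g)
∑-map g []       f = refl
∑-map g (y ∷ ys) f = cong (f (g y) +_) (∑-map g ys f)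

∑-++ : ∀ (xs ys : List A) f → ∑ (xs ++ ys) f ≡ ∑ xs f + ∑ ys f
∑-++ []       ys f = refl
∑-++ (x ∷ xs) ys f = trans (cong (f x +_) (∑-++ xs ys f)) (sym (+-assoc (f x) _ _))

∑-≤ : ∀ (xs : List A) {f c} → (∀ {x} → x ∈ₗ xs → f x ≤ c) → ∑ xs f ≤ length xs * c
∑-≤ xs {c = c} h = ≤-trans (∑-mono xs h) (≤-reflexive (∑-const xs c))

∈⇒≤∑ : ∀ {xs : List A} {x} → x ∈ₗ xs → ∀ f → f x ≤ ∑ xs f
∈⇒≤∑ (here refl) f = m≤m+n _ _
∈⇒≤∑ (there i)   f = ≤-trans (∈⇒≤∑ i f) (m≤n+m _ _)

#-mono : (P? : Decidable P) (Q? : Decidable Q) (xs : List A) →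
         (∀ {x} → x ∈ₗ xs → P x → Q x) → # P? xs ≤ # Q? xs
#-mono P? Q? xs h = ∑-mono xs λ {x} i →
  ind-≤ (P? x) λ p → ≤-reflexive (sym (ind-yes (Q? x) (h i p)))

#-cong : (P? : Decidable P) (Q? : Decidable Q) (xs : List A) →
         (∀ {x} → x ∈ₗ xs → P x → Q x) → (∀ {x} → x ∈ₗ xs → Q x → P x) → # P? xs ≡ # Q? xs
#-cong P? Q? xs f g = ≤-antisym (#-mono P? Q? xs f) (#-mono Q? P? xs g)

#-cover : (P? : Decidable P) (Q? : Decidable Q) (R? : Decidable R) (xs : List A) →
          (∀ {x} → x ∈ₗ xs → P x → Q x ⊎ R x) → # P? xs ≤ # Q? xs + # R? xs
#-cover P? Q? R? xs h = ≤-trans (∑-mono xs step) (≤-reflexive (∑-distrib-+ xs _ _))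
  where
  step : ∀ {x} → x ∈ₗ xs → ind (P? x) ≤ ind (Q? x) + ind (R? x)
  step {x} i = ind-≤ (P? x) λ p → case h i p of λ where
    (inj₁ q) → ≤-trans (≤-reflexive (sym (ind-yes (Q? x) q))) (m≤m+n _ _)
    (inj₂ r) → ≤-trans (≤-reflexive (sym (ind-yes (R? x) r))) (m≤n+m _ _)

#-pack : (P? : Decidable P) (Q? : Decidable Q) (R? : Decidable R) (xs : List A) →
         (∀ {x} → x ∈ₗ xs → P x → R x) → (∀ {x} → x ∈ₗ xs → Q x → R x) →
         (∀ {x} → x ∈ₗ xs → P x → ¬ Q x) → # P? xs + # Q? xs ≤ # R? xs
#-pack P? Q? R? xs f g h = ≤-trans (≤-reflexive (sym (∑-distrib-+ xs _ _))) (∑-mono xs step)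
  where
  step : ∀ {x} → x ∈ₗ xs → ind (P? x) + ind (Q? x) ≤ ind (R? x)
  step {x} i with P? x | Q? x
  ... | yes p | yes q = contradiction q (h i p)
  ... | yes p | no  _ = ≤-reflexive (sym (ind-yes (R? x) (f i p)))
  ... | no  _ | yes q = ≤-reflexive (sym (ind-yes (R? x) (g i q)))
  ... | no  _ | no  _ = z≤n

#-compl : (P? : Decidable P) (xs : List A) → # P? xs + # (λ x → ¬? (P? x)) xs ≡ length xs
#-compl P? []       = refl
#-compl P? (x ∷ xs) with P? x
... | yes _ = cong suc (#-compl P? xs)
... | no  _ = trans (+-suc _ _) (cong suc (#-compl P? xs))

-- The union bound over a list of indices: after the two sums are exchanged, each counted `x` still
-- contributes at least 1. Points, members and pairs of points all serve as indices later.
#-⋃ : {P : Pred A 0ℓ} {S : B → Pred A 0ℓ} (P? : Decidable P) (ys : List B) (S? : ∀ y → Decidable (S y)) →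
      (xs : List A) → (∀ {x} → x ∈ₗ xs → P x → ∃[ y ] y ∈ₗ ys × S y x) →
      # P? xs ≤ ∑ ys (λ y → # (S? y) xs)
#-⋃ P? ys S? xs h = ≤-trans (∑-mono xs step) (≤-reflexive (∑-swap xs ys _))
  where
  step : ∀ {x} → x ∈ₗ xs → ind (P? x) ≤ ∑ ys (λ y → ind (S? y x))
  step {x} i = ind-≤ (P? x) λ p → case h i p of λ where
    (y , y∈ , r) → ≤-trans (≤-reflexive (sym (ind-yes (S? y x) r))) (∈⇒≤∑ y∈ _)

#≡length-filter : (P? : Decidable P) (xs : List A) → # P? xs ≡ length (filter P? xs)
#≡length-filter P? []       = refl
#≡length-filter P? (x ∷ xs) with P? x
... | yes _ = cong suc (#≡length-filter P? xs)
... | no  _ = #≡length-filter P? xs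

#-none : (P? : Decidable P) (xs : List A) → (∀ {x} → x ∈ₗ xs → ¬ P x) → # P? xs ≡ 0
#-none P? xs h =
  trans (∑-cong xs λ {x} i → ind-no (P? x) (h i)) (trans (∑-const xs 0) (*-zeroʳ (length xs)))

#-all : (P? : Decidable P) (xs : List A) → (∀ {x} → x ∈ₗ xs → P x) → # P? xs ≡ length xs
#-all P? xs h =
  trans (∑-cong xs λ {x} i → ind-yes (P? x) (h i)) (trans (∑-const xs 1) (*-identityʳ (length xs)))

#-≤1 : (P? : Decidable P) {xs : List A} → Unique xs → (∀ {x y} → P x → P y → x ≡ y) → # P? xs ≤ 1
#-≤1 P? {[]}     []       h = z≤n
#-≤1 P? {x ∷ xs} (x∉ ∷ u) h with P? x
... | yes p = s≤s (≤-reflexive (#-none P? xs λ i q → All.lookup x∉ i (h p q)))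
... | no  _ = #-≤1 P? u h

-- Supplies the explicit lists of distinct members to which the union-intersecting hypothesis is
-- applied.
#-choose : {P : Pred A ℓ} (P? : Decidable P) {xs : List A} → Unique xs → ∀ {r} → r ≤ # P? xs →
           ∃[ ys ] length ys ≡ r × Unique ys × (∀ {y} → y ∈ₗ ys → y ∈ₗ xs × P y)
#-choose P? {xs} u {r} r≤ = take r ys , len , Unique.take⁺ r (Unique.filter⁺ P? u) ,
    (λ i → Mem.∈-filter⁻ P? {xs = xs} (∈-take r ys i))
  where
  ys = filter P? xs
  len : length (take r ys) ≡ r
  len = trans (List.length-take r ys) (m≤n⇒m⊓n≡m (≤-trans r≤ (≤-reflexive (#≡length-filter P? xs))))
  ∈-take : ∀ r (zs : List _) {z} → z ∈ₗ take r zs → z ∈ₗ zs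
  ∈-take (suc r) (z ∷ zs) (here e)  = here e
  ∈-take (suc r) (z ∷ zs) (there i) = there (∈-take r zs i)

module _ {A : Set} (_≟_ : ∀ (x y : A) → Dec (x ≡ y)) where

  -- Each entry of `ys` equals at most one entry of `xs`, because `xs` has no repetitions.
  Unique-⊆⇒length≤ : ∀ {xs ys : List A} → Unique xs → (∀ {x} → x ∈ₗ xs → x ∈ₗ ys) → length xs ≤ length ys
  Unique-⊆⇒length≤ {xs} {ys} u h = begin
    length xs                               ≡⟨ #-all (λ x → x ≟ x) xs (λ _ → refl) ⟨
    # (λ x → x ≟ x) xs                      ≤⟨ #-⋃ (λ x → x ≟ x) ys (λ y x → x ≟ y) xs (λ {x} i _ → x , h i , refl) ⟩
    ∑ ys (λ y → # (_≟ y) xs)                ≤⟨ ∑-≤ ys (λ {y} _ → #-≤1 (_≟ y) u λ p q → trans p (sym q)) ⟩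
    length ys * 1                           ≡⟨ *-identityʳ _ ⟩
    length ys                               ∎
    where open ≤-Reasoning

  -- An entry of `ys` missing from `xs` could be put in front of `xs`, and the longer list would
  -- contradict the previous bound. In the equality case this turns a comparison of sizes into an
  -- inclusion of families.
  Unique-⊆-length≥⇒⊇ : ∀ {xs ys : List A} → Unique xs → (∀ {x} → x ∈ₗ xs → x ∈ₗ ys) →
                       length ys ≤ length xs → ∀ {y} → y ∈ₗ ys → y ∈ₗ xs
  Unique-⊆-length≥⇒⊇ {xs} {ys} u h le {y} y∈ with DecMem._∈?_ _≟_ y xs
  ... | yes i = i
  ... | no  ∉ = contradiction (Unique-⊆⇒length≤ u′ h′) (<⇒≱ (s≤s le))
    where
    u′ : Unique (y ∷ xs)
    u′ = All.tabulate (λ { i refl → ∉ i }) ∷ u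
    h′ : ∀ {x} → x ∈ₗ y ∷ xs → x ∈ₗ ys
    h′ (here refl) = y∈
    h′ (there i)   = h i

-- Subsets

_≟ₛ_ : (X Y : Subset n) → Dec (X ≡ Y)
_≟ₛ_ = Vec.≡-dec Bool._≟_

∑-allFin-suc : ∀ n (f : Fin (suc n) → ℕ) → ∑ (allFin (suc n)) f ≡ f zero + ∑ (allFin n) (f ∘ suc)
∑-allFin-suc n f = cong (f zero +_)
  (trans (cong (λ xs → ∑ xs f) (sym (List.map-tabulate id suc))) (∑-map suc (allFin n) f))

∣p∣≡# : (X : Subset n) → ∣ X ∣ ≡ # (_∈? X) (allFin n)
∣p∣≡# []          = refl
∣p∣≡# {suc n} (true ∷ X)  = trans (cong suc (trans (∣p∣≡# X)
  (#-cong (_∈? X) (λ i → suc i ∈? true ∷ X) (allFin n) (λ _ → there) (λ _ → drop-there))))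
  (sym (∑-allFin-suc n (λ i → ind (i ∈? true ∷ X))))
∣p∣≡# {suc n} (false ∷ X) = trans (trans (∣p∣≡# X)
  (#-cong (_∈? X) (λ i → suc i ∈? false ∷ X) (allFin n) (λ _ → there) (λ _ → drop-there)))
  (sym (∑-allFin-suc n (λ i → ind (i ∈? false ∷ X))))

meet⊎∣∪∣≡+ : (X Y : Subset n) → Nonempty (X ∩ Y) ⊎ ∣ X ∪ Y ∣ ≡ ∣ X ∣ + ∣ Y ∣
meet⊎∣∪∣≡+ []          []          = inj₂ refl
meet⊎∣∪∣≡+ (true ∷ X)  (true ∷ Y)  = inj₁ (zero , here)
meet⊎∣∪∣≡+ (x ∷ X)     (y ∷ Y)     with meet⊎∣∪∣≡+ X Y
meet⊎∣∪∣≡+ (x ∷ X)     (y ∷ Y)     | inj₁ (i , i∈) = inj₁ (suc i , there i∈)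
meet⊎∣∪∣≡+ (true ∷ X)  (false ∷ Y) | inj₂ e = inj₂ (cong suc e)
meet⊎∣∪∣≡+ (false ∷ X) (true ∷ Y)  | inj₂ e = inj₂ (trans (cong suc e) (sym (+-suc ∣ X ∣ _)))
meet⊎∣∪∣≡+ (false ∷ X) (false ∷ Y) | inj₂ e = inj₂ e
meet⊎∣∪∣≡+ (true ∷ X)  (true ∷ Y)  | inj₂ _ = inj₁ (zero , here)

meet⁺ : {X Y : Subset n} {i : Fin n} → i ∈ X → i ∈ Y → Nonempty (X ∩ Y)
meet⁺ p q = _ , x∈p∩q⁺ (p , q)

meet⁻ : (X Y : Subset n) → Nonempty (X ∩ Y) → ∃[ i ] i ∈ X × i ∈ Y
meet⁻ X Y (i , i∈) = i , x∈p∩q⁻ X Y i∈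

meet? : (X Y : Subset n) → Dec (Nonempty (X ∩ Y))
meet? X Y = nonempty? (X ∩ Y)

∣⁅i⁆∪p∣ : {X : Subset n} {i : Fin n} → i ∉ X → ∣ ⁅ i ⁆ ∪ X ∣ ≡ suc ∣ X ∣
∣⁅i⁆∪p∣ {X = X} {i} i∉ with meet⊎∣∪∣≡+ ⁅ i ⁆ X
... | inj₁ m = case meet⁻ ⁅ i ⁆ X m of λ where
  (j , j∈ , j∈X) → contradiction (subst (_∈ X) (x∈⁅y⁆⇒x≡y i j∈) j∈X) i∉
... | inj₂ e = trans e (cong (_+ ∣ X ∣) (∣⁅x⁆∣≡1 i))

insert-⊆ : {X Y : Subset n} {i : Fin n} → i ∈ Y → X ⊆ Y → ⁅ i ⁆ ∪ X ⊆ Y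
insert-⊆ {X = X} {Y} {i} i∈ X⊆Y j∈ with x∈p∪q⁻ ⁅ i ⁆ X j∈
... | inj₁ j∈i = subst (_∈ Y) (sym (x∈⁅y⁆⇒x≡y i j∈i)) i∈
... | inj₂ j∈X = X⊆Y j∈X

⁅i⁆⊆ : {Y : Subset n} {i : Fin n} → i ∈ Y → ⁅ i ⁆ ⊆ Y
⁅i⁆⊆ {Y = Y} {i} i∈ j∈ = subst (_∈ Y) (sym (x∈⁅y⁆⇒x≡y i j∈)) i∈

nonempty-of-∣∣ : {X : Subset n} → 1 ≤ ∣ X ∣ → Nonempty X
nonempty-of-∣∣ {n} {X} h with nonempty? X
... | yes ne = ne
... | no ¬ne = contradiction (subst (1 ≤_) (trans (cong ∣_∣ (Empty-unique ¬ne)) (∣⊥∣≡0 n)) h) λ ()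

⊆∧∣∣≥⇒≡ : {X Y : Subset n} → X ⊆ Y → ∣ Y ∣ ≤ ∣ X ∣ → X ≡ Y
⊆∧∣∣≥⇒≡ {X = X} {Y} X⊆Y le = ⊆-antisym X⊆Y λ {j} j∈ → case j ∈? X of λ where
  (yes p) → p
  (no ∉)  → contradiction (p⊂q⇒∣p∣<∣q∣ (X⊆Y , j , j∈ , ∉)) (≤⇒≯ le)

-- The Boolean cube and the number of k-sets between two given sets

cube : ∀ n → List (Subset n)
cube zero    = [] ∷ []
cube (suc n) = map (true ∷_) (cube n) ++ map (false ∷_) (cube n)

∈-cube : (X : Subset n) → X ∈ₗ cube n
∈-cube []          = here refl
∈-cube (true ∷ X)  = Mem.∈-++⁺ˡ (Mem.∈-map⁺ (true ∷_) (∈-cube X))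
∈-cube (false ∷ X) = Mem.∈-++⁺ʳ (map (true ∷_) (cube _)) (Mem.∈-map⁺ (false ∷_) (∈-cube X))

cube-unique : ∀ n → Unique (cube n)
cube-unique zero    = [] ∷ []
cube-unique (suc n) = Unique.++⁺ (Unique.map⁺ Vec.∷-injectiveʳ (cube-unique n))
  (Unique.map⁺ Vec.∷-injectiveʳ (cube-unique n)) disj
  where
  disj : Disjoint (map (true ∷_) (cube n)) (map (false ∷_) (cube n))
  disj (p , q) with Mem.∈-map⁻ (true ∷_) p | Mem.∈-map⁻ (false ∷_) q
  ... | _ , _ , refl | _ , _ , ()

#-cube-suc : ∀ {n} {P : Pred (Subset (suc n)) 0ℓ} (P? : Decidable P) →
             # P? (cube (suc n)) ≡ # (λ X → P? (true ∷ X)) (cube n) + # (λ X → P? (false ∷ X)) (cube n)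
#-cube-suc {n} P? = trans (∑-++ (map (true ∷_) (cube n)) _ _)
  (cong₂ _+_ (∑-map (true ∷_) (cube n) _) (∑-map (false ∷_) (cube n) _))

Between : (X Z : Subset n) (k : ℕ) → Pred (Subset n) 0ℓ
Between X Z k A = ∣ A ∣ ≡ k × X ⊆ A × A ⊆ Z

between? : (X Z : Subset n) (k : ℕ) → Decidable (Between X Z k)
between? X Z k A = (∣ A ∣ ≟ k) ×-dec ((X ⊆? A) ×-dec (A ⊆? Z))

nC0≡1 : ∀ n → n C 0 ≡ 1
nC0≡1 n = trans (nCk≡nC[n∸k] {0} {n} z≤n) (nCn≡1 n)

-- Induction on the coordinates. A point of `X` or outside `Z` is forced; a point of `Z` outside `X`
-- is free and gives one step of Pascal's rule. Writing the sizes as `∣ X ∣ + f` and `∣ X ∣ + r`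
-- avoids truncated subtraction.
#-between : (X Z : Subset n) (f r : ℕ) → X ⊆ Z → ∣ Z ∣ ≡ ∣ X ∣ + f →
            # (between? X Z (∣ X ∣ + r)) (cube n) ≡ f C r
#-between [] [] zero    zero    _ _ = refl
#-between [] [] zero    (suc r) _ _ = sym (k>n⇒nCk≡0 {0} {suc r} (s≤s z≤n))
#-between [] [] (suc f) r       _ ()
#-between {suc n} X̂@(true ∷ X) Ẑ@(true ∷ Z) f r sub e = begin
  # (between? X̂ Ẑ (∣ X̂ ∣ + r)) (cube (suc n))                   ≡⟨ #-cube-suc (between? X̂ Ẑ (∣ X̂ ∣ + r)) ⟩
  # (λ A → between? X̂ Ẑ (∣ X̂ ∣ + r) (true ∷ A)) (cube n) +
  # (λ A → between? X̂ Ẑ (∣ X̂ ∣ + r) (false ∷ A)) (cube n)         ≡⟨ cong₂ _+_ with0 without0 ⟩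
  f C r + 0                                                   ≡⟨ +-identityʳ _ ⟩
  f C r                                                       ∎
  where
  open ≡-Reasoning
  with0 = trans (#-cong (λ A → between? X̂ Ẑ (∣ X̂ ∣ + r) (true ∷ A)) (between? X Z (∣ X ∣ + r)) (cube n)
      (λ { _ (c , l , u) → suc-injective c , drop-∷-⊆ l , drop-∷-⊆ u })
      (λ { _ (c , l , u) → cong suc c , in⊆in l , in⊆in u }))
    (#-between X Z f r (drop-∷-⊆ sub) (suc-injective e))
  without0 = #-none (λ A → between? X̂ Ẑ (∣ X̂ ∣ + r) (false ∷ A)) (cube n) λ { _ (_ , l , _) → case l here of λ () }
#-between {suc n} X̂@(false ∷ X) Ẑ@(false ∷ Z) f r sub e = begin
  # (between? X̂ Ẑ (∣ X̂ ∣ + r)) (cube (suc n))                   ≡⟨ #-cube-suc (between? X̂ Ẑ (∣ X̂ ∣ + r)) ⟩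
  # (λ A → between? X̂ Ẑ (∣ X̂ ∣ + r) (true ∷ A)) (cube n) +
  # (λ A → between? X̂ Ẑ (∣ X̂ ∣ + r) (false ∷ A)) (cube n)         ≡⟨ cong₂ _+_ with0 without0 ⟩
  f C r                                                       ∎
  where
  open ≡-Reasoning
  without0 = trans (#-cong (λ A → between? X̂ Ẑ (∣ X̂ ∣ + r) (false ∷ A)) (between? X Z (∣ X ∣ + r)) (cube n)
      (λ { _ (c , l , u) → c , drop-∷-⊆ l , drop-∷-⊆ u })
      (λ { _ (c , l , u) → c , out⊆ l , out⊆ u }))
    (#-between X Z f r (drop-∷-⊆ sub) e)
  with0 = #-none (λ A → between? X̂ Ẑ (∣ X̂ ∣ + r) (true ∷ A)) (cube n) λ { _ (_ , _ , u) → case u here of λ () }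
#-between (true ∷ X) (false ∷ Z) f r sub e = case sub here of λ ()
#-between {suc n} (false ∷ X) (true ∷ Z) zero r sub e =
  contradiction (p⊆q⇒∣p∣≤∣q∣ (drop-∷-⊆ sub)) (<⇒≱ (≤-reflexive (trans e (+-identityʳ ∣ X ∣))))
#-between {suc n} X̂@(false ∷ X) Ẑ@(true ∷ Z) (suc f) r sub e = begin
  # (between? X̂ Ẑ (∣ X̂ ∣ + r)) (cube (suc n))                   ≡⟨ #-cube-suc (between? X̂ Ẑ (∣ X̂ ∣ + r)) ⟩
  # (λ A → between? X̂ Ẑ (∣ X̂ ∣ + r) (true ∷ A)) (cube n) +
  # (λ A → between? X̂ Ẑ (∣ X̂ ∣ + r) (false ∷ A)) (cube n)         ≡⟨ split r ⟩
  suc f C r                                                   ∎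
  where
  open ≡-Reasoning
  e′ : ∣ Z ∣ ≡ ∣ X ∣ + f
  e′ = suc-injective (trans e (+-suc ∣ X ∣ f))
  without0 : ∀ r → # (λ A → between? X̂ Ẑ (∣ X̂ ∣ + r) (false ∷ A)) (cube n) ≡ f C r
  without0 r = trans (#-cong (λ A → between? X̂ Ẑ (∣ X̂ ∣ + r) (false ∷ A)) (between? X Z (∣ X ∣ + r)) (cube n)
      (λ { _ (c , l , u) → c , drop-∷-⊆ l , drop-∷-⊆ u })
      (λ { _ (c , l , u) → c , out⊆ l , out⊆ u }))
    (#-between X Z f r (drop-∷-⊆ sub) e′)
  split : ∀ r → # (λ A → between? X̂ Ẑ (∣ X̂ ∣ + r) (true ∷ A)) (cube n) +
                # (λ A → between? X̂ Ẑ (∣ X̂ ∣ + r) (false ∷ A)) (cube n) ≡ suc f C r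
  -- For `r` = 0 the sets have only as many points as `X`, so none of them can contain `X` together
  -- with the free point.
  split zero = trans (cong₂ _+_
      (#-none (λ A → between? X̂ Ẑ (∣ X̂ ∣ + 0) (true ∷ A)) (cube n)
        λ { {A} _ (c , l , _) → contradiction (p⊆q⇒∣p∣≤∣q∣ (drop-∷-⊆ l))
          (<⇒≱ (≤-reflexive (trans c (+-identityʳ ∣ X ∣)))) })
      (without0 0))
    (trans (nC0≡1 f) (sym (nC0≡1 (suc f))))
  split (suc r) = trans (cong₂ _+_
      (trans (#-cong (λ A → between? X̂ Ẑ (∣ X̂ ∣ + suc r) (true ∷ A)) (between? X Z (∣ X ∣ + r)) (cube n)
        (λ { _ (c , l , u) → suc-injective (trans c (+-suc ∣ X ∣ r)) , drop-∷-⊆ l , drop-∷-⊆ u })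
        (λ { _ (c , l , u) → trans (cong suc c) (sym (+-suc ∣ X ∣ r)) , out⊆ l , in⊆in u }))
        (#-between X Z f r (drop-∷-⊆ sub) e′))
      (without0 (suc r)))
    (nCk+nC[k+1]≡[n+1]C[k+1] f r)

#-between′ : (X Z : Subset n) (k f r : ℕ) → X ⊆ Z → ∣ Z ∣ ≡ ∣ X ∣ + f → k ≡ ∣ X ∣ + r →
             # (between? X Z k) (cube n) ≡ f C r
#-between′ X Z k f r sub e refl = #-between X Z f r sub e

#≤#cube : {P : Pred (Subset n) 0ℓ} {Q : Pred (Subset n) 0ℓ} (P? : Decidable P) (Q? : Decidable Q)
          {F : List (Subset n)} → Unique F → (∀ {A} → A ∈ₗ F → P A → Q A) → # P? F ≤ # Q? (cube n)
#≤#cube P? Q? {F} u h = subst₂ _≤_ (sym (#≡length-filter P? F)) (sym (#≡length-filter Q? (cube _)))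
  (Unique-⊆⇒length≤ _≟ₛ_ (Unique.filter⁺ P? u)
    λ {A} i → case Mem.∈-filter⁻ P? {xs = F} i of λ { (A∈ , p) → Mem.∈-filter⁺ Q? (∈-cube A) (h A∈ p) })

C-suc-mono : ∀ n r → n C r ≤ suc n C r
C-suc-mono n zero    = ≤-reflexive (trans (nC0≡1 n) (sym (nC0≡1 (suc n))))
C-suc-mono n (suc r) = ≤-trans (m≤n+m _ (n C r)) (≤-reflexive (nCk+nC[k+1]≡[n+1]C[k+1] n r))

C-mono-+ : ∀ j n r → n C r ≤ (j + n) C r
C-mono-+ zero    n r = ≤-refl
C-mono-+ (suc j) n r = ≤-trans (C-mono-+ j n r) (C-suc-mono (j + n) r)

-- The exact number of k-sets containing `X` is `(n ∸ ∣ X ∣) C r`; rounding up to `n C r` keeps the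
-- size of `X` out of the later estimates.
#-supersets≤ : {P : Pred (Subset n) 0ℓ} (P? : Decidable P) {F : List (Subset n)} → Unique F → ∀ k r (X : Subset n) →
               k ≡ ∣ X ∣ + r → (∀ {A} → A ∈ₗ F → ∣ A ∣ ≡ k) → (∀ {A} → P A → X ⊆ A) → # P? F ≤ n C r
#-supersets≤ {n} P? {F} u k r X e uni h = begin
  # P? F                                   ≤⟨ #≤#cube P? (between? X full k) u (λ i p → uni i , h p , ⊆-max _) ⟩
  # (between? X full k) (cube n)              ≡⟨ #-between′ X full k (n ∸ ∣ X ∣) r (⊆-max X) (trans (∣⊤∣≡n n) (sym (m+[n∸m]≡n (∣p∣≤n X)))) e ⟩
  (n ∸ ∣ X ∣) C r                          ≤⟨ C-mono-+ ∣ X ∣ (n ∸ ∣ X ∣) r ⟩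
  (∣ X ∣ + (n ∸ ∣ X ∣)) C r                ≡⟨ cong (_C r) (m+[n∸m]≡n (∣p∣≤n X)) ⟩
  n C r                                    ∎
  where open ≤-Reasoning

-- For S = T(A_1, ..., A_p : s) of the extremal size this will turn out to be S_1(A_1, ..., A_p :
-- s), in a form that is easy to count.
StarHit : ℕ → Subset (suc n) → Pred (Subset (suc n)) 0ℓ
StarHit k S A = ∣ A ∣ ≡ k × zero ∈ A × Nonempty (A ∩ S)

starHit? : (k : ℕ) (S : Subset (suc n)) → Decidable (StarHit k S)
starHit? k S A = (∣ A ∣ ≟ k) ×-dec ((zero ∈? A) ×-dec meet? A S)

-- Among the k-sets through `zero`, those that miss `S` are the ones between {zero} and `∁ S`. Both
-- numbers are binomial coefficients, and the sets that hit `S` are their difference.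
#-starHit : ∀ k (S : Subset (suc n)) → 1 ≤ k → zero ∉ S →
            # (starHit? k S) (cube (suc n)) ≡ (suc n ∸ 1) C (k ∸ 1) ∸ (suc n ∸ ∣ S ∣ ∸ 1) C (k ∸ 1)
#-starHit {n} (suc k) S _ 0∉S = begin
  h                  ≡⟨ m+n∸n≡m h m ⟨
  h + m ∸ m          ≡⟨ cong₂ _∸_ h+m m≡ ⟩
  n C k ∸ (suc n ∸ ∣ S ∣ ∸ 1) C k ∎
  where
  open ≡-Reasoning
  X = ⁅ zero ⁆
  h = # (starHit? (suc k) S) (cube (suc n))
  m = # (between? X (∁ S) (suc k)) (cube (suc n))
  0∈∁S : zero ∈ ∁ S
  0∈∁S = x∉p⇒x∈∁p 0∉S
  S≤n : ∣ S ∣ ≤ n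
  S≤n = ≤-pred (subst (∣ S ∣ <_) (∣⊤∣≡n (suc n)) (p⊂q⇒∣p∣<∣q∣ (⊆-max S , zero , here , 0∉S)))
  m≡ : m ≡ (suc n ∸ ∣ S ∣ ∸ 1) C k
  m≡ = #-between′ X (∁ S) (suc k) _ k (⁅i⁆⊆ 0∈∁S)
    (trans (∣∁p∣≡n∸∣p∣ S) (trans (sym (m+[n∸m]≡n (m<n⇒0<n∸m (s≤s S≤n))))
      (cong (_+ (suc n ∸ ∣ S ∣ ∸ 1)) (sym (∣⁅x⁆∣≡1 (zero {n}))))))
    (cong (_+ k) (sym (∣⁅x⁆∣≡1 (zero {n}))))
  all? = between? X full (suc k)
  all≡ : # all? (cube (suc n)) ≡ n C k
  all≡ = #-between′ X full (suc k) n k (⊆-max X) (trans (∣⊤∣≡n (suc n)) (cong (_+ n) (sym (∣⁅x⁆∣≡1 (zero {n})))))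
    (cong (_+ k) (sym (∣⁅x⁆∣≡1 (zero {n}))))
  h+m : h + m ≡ n C k
  h+m = trans (≤-antisym
    (#-pack (starHit? (suc k) S) (between? X (∁ S) (suc k)) all? (cube (suc n))
      (λ { {A} _ (c , 0∈ , _) → c , ⁅i⁆⊆ {Y = A} 0∈ , ⊆-max A })
      (λ { {A} _ (c , l , _) → c , l , ⊆-max A })
      (λ { {A} _ (_ , _ , hit) (_ , _ , u) → case meet⁻ A S hit of λ { (i , i∈A , i∈S) → x∈∁p⇒x∉p (u i∈A) i∈S } }))
    (#-cover all? (starHit? (suc k) S) (between? X (∁ S) (suc k)) (cube (suc n))
      λ { {A} _ (c , l , _) → case meet? A S of λ where
        (yes hit) → inj₁ (c , l (x∈⁅x⁆ zero) , hit)
        (no miss) → inj₂ (c , (λ {j} → l {j}) , λ {j} i∈A → x∉p⇒x∈∁p λ i∈S → miss (meet⁺ i∈A i∈S)) }))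
    all≡

-- Union-intersecting families

⋃-tabulate⁺ : ∀ {p} (a : Fin p → Subset n) i {x} → x ∈ a i → x ∈ bigUnion a
⋃-tabulate⁺ a zero    x∈ = x∈p∪q⁺ (inj₁ x∈)
⋃-tabulate⁺ a (suc i) x∈ = x∈p∪q⁺ (inj₂ (⋃-tabulate⁺ (a ∘ suc) i x∈))

⋃-tabulate⁻ : ∀ {p} (a : Fin p → Subset n) {x} → x ∈ bigUnion a → ∃[ i ] x ∈ a i
⋃-tabulate⁻ {p = zero}  a x∈ = contradiction x∈ ∉⊥
⋃-tabulate⁻ {p = suc p} a x∈ with x∈p∪q⁻ (a zero) _ x∈
... | inj₁ x∈₀ = zero , x∈₀
... | inj₂ x∈₁ with ⋃-tabulate⁻ (a ∘ suc) x∈₁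
...   | i , x∈ᵢ = suc i , x∈ᵢ

-- The conclusion of `UnionIntersecting` without unions: some set of the first block and some set of
-- the second share a point `v`.
Crossing : ∀ s t → (Fin (s + t) → Subset n) → Set
Crossing s t c = ∃[ i ] ∃[ j ] ∃[ v ] v ∈ c (i ↑ˡ t) × v ∈ c (s ↑ʳ j)

crossing⁻ : ∀ s t (c : Fin (s + t) → Subset n) →
            Nonempty (bigUnion (λ i → c (i ↑ˡ t)) ∩ bigUnion (λ j → c (s ↑ʳ j))) → Crossing s t c
crossing⁻ s t c ne with meet⁻ (bigUnion (λ i → c (i ↑ˡ t))) (bigUnion (λ j → c (s ↑ʳ j))) ne
... | v , v∈₁ , v∈₂ with ⋃-tabulate⁻ (λ i → c (i ↑ˡ t)) v∈₁ | ⋃-tabulate⁻ (λ j → c (s ↑ʳ j)) v∈₂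
...   | i , v∈i | j , v∈j = i , j , v , v∈i , v∈j

crossing⁺ : ∀ s t (c : Fin (s + t) → Subset n) → Crossing s t c →
            Nonempty (bigUnion (λ i → c (i ↑ˡ t)) ∩ bigUnion (λ j → c (s ↑ʳ j)))
crossing⁺ s t c (i , j , v , v∈i , v∈j) =
  meet⁺ (⋃-tabulate⁺ (λ i → c (i ↑ˡ t)) i v∈i) (⋃-tabulate⁺ (λ j → c (s ↑ʳ j)) j v∈j)

append : ∀ {p q} → (Fin p → A) → (Fin q → A) → Fin (p + q) → A
append {p = p} a b i = [ a , b ]′ (splitAt p i)

append-↑ˡ : ∀ {p q} (a : Fin p → A) (b : Fin q → A) i → append a b (i ↑ˡ q) ≡ a i
append-↑ˡ {p = p} {q} a b i = cong [ a , b ]′ (Fin.splitAt-↑ˡ p i q)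

append-↑ʳ : ∀ {p q} (a : Fin p → A) (b : Fin q → A) j → append a b (p ↑ʳ j) ≡ b j
append-↑ʳ {p = p} {q} a b j = cong [ a , b ]′ (Fin.splitAt-↑ʳ p q j)

append-elim : ∀ {p q} (a : Fin p → A) (b : Fin q → A) {P : Pred A 0ℓ} →
              (∀ i → P (a i)) → (∀ j → P (b j)) → ∀ i → P (append a b i)
append-elim {p = p} a b f g i with splitAt p i
... | inj₁ x = f x
... | inj₂ y = g y

append-injective : ∀ {p q} (a : Fin p → A) (b : Fin q → A) → Injective _≡_ _≡_ a → Injective _≡_ _≡_ b →
                   (∀ i j → a i ≢ b j) → Injective _≡_ _≡_ (append a b)
append-injective {p = p} a b ai bi a≢b {x} {y} e with splitAt p x in ex | splitAt p y in ey
... | inj₁ i | inj₁ j = trans (sym (Fin.splitAt⁻¹-↑ˡ ex)) (trans (cong (_↑ˡ _) (ai e)) (Fin.splitAt⁻¹-↑ˡ ey))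
... | inj₁ i | inj₂ j = contradiction e (a≢b i j)
... | inj₂ i | inj₁ j = contradiction (sym e) (a≢b j i)
... | inj₂ i | inj₂ j = trans (sym (Fin.splitAt⁻¹-↑ʳ ex)) (trans (cong (p ↑ʳ_) (bi e)) (Fin.splitAt⁻¹-↑ʳ ey))

lookup-injective : {xs : List A} → Unique xs → Injective _≡_ _≡_ (lookup xs)
lookup-injective {xs = x ∷ xs} (x∉ ∷ u) {zero}  {zero}  e = refl
lookup-injective {xs = x ∷ xs} (x∉ ∷ u) {zero}  {suc j} e = contradiction e (All.lookup x∉ (Mem.∈-lookup j))
lookup-injective {xs = x ∷ xs} (x∉ ∷ u) {suc i} {zero}  e = contradiction (sym e) (All.lookup x∉ (Mem.∈-lookup i))
lookup-injective {xs = x ∷ xs} (x∉ ∷ u) {suc i} {suc j} e = cong suc (lookup-injective u e)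

module UniformFamily {n : ℕ} (k s t : ℕ) (1≤k : 1 ≤ k) (F : List (Subset n)) (unique : Unique F)
                     (uniform : ∀ {A} → A ∈ₗ F → ∣ A ∣ ≡ k) (ui : UnionIntersecting s t F) where

  nonempty : ∀ {A} → A ∈ₗ F → Nonempty A
  nonempty A∈ = nonempty-of-∣∣ (subst (1 ≤_) (sym (uniform A∈)) 1≤k)

  -- A member common to both lists would be nonempty, as k ≥ 1, and so would meet itself. Hence the
  -- two lists together consist of `s + t` distinct members and `ui` applies.
  ¬disjointLists : ∀ xs ys → Unique xs → Unique ys → (∀ {A} → A ∈ₗ xs → A ∈ₗ F) → (∀ {A} → A ∈ₗ ys → A ∈ₗ F) →
                   length xs ≡ s → length ys ≡ t → ¬ (∀ {A B} → A ∈ₗ xs → B ∈ₗ ys → ¬ Nonempty (A ∩ B))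
  ¬disjointLists xs ys uxs uys xs⊆ ys⊆ refl refl disj =
    case crossing⁻ (length xs) (length ys) c (ui c c-injective c∈F) of λ where
      (i , j , v , v∈i , v∈j) → disj (Mem.∈-lookup i) (Mem.∈-lookup j)
        (meet⁺ (subst (v ∈_) (append-↑ˡ (lookup xs) (lookup ys) i) v∈i)
               (subst (v ∈_) (append-↑ʳ (lookup xs) (lookup ys) j) v∈j))
    where
    c = append (lookup xs) (lookup ys)
    c∈F : ∀ i → c i ∈ₗ F
    c∈F = append-elim (lookup xs) (lookup ys) {_∈ₗ F} (xs⊆ ∘ Mem.∈-lookup) (ys⊆ ∘ Mem.∈-lookup)
    xs≢ys : ∀ i j → lookup xs i ≢ lookup ys j
    xs≢ys i j e with nonempty (xs⊆ (Mem.∈-lookup i))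
    ... | v , v∈ = disj (Mem.∈-lookup i) (Mem.∈-lookup j) (meet⁺ v∈ (subst (v ∈_) e v∈))
    c-injective : Injective _≡_ _≡_ c
    c-injective = append-injective (lookup xs) (lookup ys) (lookup-injective uxs) (lookup-injective uys) xs≢ys

  -- Otherwise `t` members with `Q` would form a second block whose union is disjoint from the union
  -- of `xs`.
  #-disjointFromList<t : ∀ xs → Unique xs → (∀ {A} → A ∈ₗ xs → A ∈ₗ F) → length xs ≡ s →
            {Q : Pred (Subset n) 0ℓ} (Q? : Decidable Q) →
            (∀ {A B} → A ∈ₗ xs → B ∈ₗ F → Q B → ¬ Nonempty (A ∩ B)) → # Q? F < t
  #-disjointFromList<t xs uxs xs⊆ len Q? disj = ≰⇒> λ t≤ → case #-choose Q? unique t≤ of λ where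
    (ys , leny , uys , ys⊆) → ¬disjointLists xs ys uxs uys xs⊆ (proj₁ ∘ ys⊆) len leny
      λ A∈ B∈ → disj A∈ (proj₁ (ys⊆ B∈)) (proj₂ (ys⊆ B∈))

  #-disjoint<t : {P Q : Pred (Subset n) 0ℓ} (P? : Decidable P) (Q? : Decidable Q) → s ≤ # P? F →
                 (∀ {A B} → A ∈ₗ F → B ∈ₗ F → P A → Q B → ¬ Nonempty (A ∩ B)) → # Q? F < t
  #-disjoint<t P? Q? s≤ disj = case #-choose P? unique s≤ of λ where
    (xs , len , uxs , xs⊆) → #-disjointFromList<t xs uxs (proj₁ ∘ xs⊆) len Q?
      λ A∈ B∈ → disj (proj₁ (xs⊆ A∈)) B∈ (proj₂ (xs⊆ A∈))

  -- All but fewer than t members meet the union of any s members, and that union has at most sk points.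
  #-≤-localDegrees : {P Q : Pred (Subset n) 0ℓ} (P? : Decidable P) (Q? : Decidable Q) {E : ℕ} → s ≤ # Q? F →
    (∀ {B v} → B ∈ₗ F → Q B → v ∈ B → # (λ A → P? A ×-dec (v ∈? A)) F ≤ E) →
    # P? F ≤ t + s * (k * E)
  #-≤-localDegrees {P} {Q} P? Q? {E} s≤ local with #-choose Q? unique s≤
  ... | Bs , refl , uBs , Bs⊆ = begin
    # P? F                             ≤⟨ #-cover P? miss? hit? F (λ {A} _ p → case miss? A of λ where
                                            (yes m) → inj₁ m
                                            (no ¬m) → inj₂ (p , ¬m)) ⟩
    # miss? F + # hit? F               ≤⟨ +-mono-≤ (<⇒≤ miss<t) (#-⋃ hit? Bs through? F hit⇒through) ⟩
    t + ∑ Bs (λ B → # (through? B) F)  ≤⟨ +-monoʳ-≤ t (∑-≤ Bs through≤) ⟩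
    t + length Bs * (k * E)            ∎
    where
    open ≤-Reasoning
    miss? = λ A → All.all? (λ B → ¬? (meet? B A)) Bs
    hit? = λ A → P? A ×-dec ¬? (miss? A)
    through? = λ B A → P? A ×-dec meet? B A
    at? = λ v A → P? A ×-dec (v ∈? A)
    miss<t : # miss? F < t
    miss<t = #-disjointFromList<t Bs uBs (proj₁ ∘ Bs⊆) refl miss? λ B∈ _ m → All.lookup m B∈
    hit⇒through : ∀ {A} → A ∈ₗ F → P A × ¬ All (λ B → ¬ Nonempty (B ∩ A)) Bs →
                  ∃[ B ] B ∈ₗ Bs × P A × Nonempty (B ∩ A)
    hit⇒through {A} _ (p , ¬m) with Mem.find (All.¬All⇒Any¬ (λ B → ¬? (meet? B A)) Bs ¬m)
    ... | B , B∈ , ¬¬m = B , B∈ , p , decidable-stable (meet? B A) ¬¬m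
    through≤ : ∀ {B} → B ∈ₗ Bs → # (through? B) F ≤ k * E
    through≤ {B} B∈ = begin
      # (through? B) F                                     ≤⟨ #-⋃ (through? B) (allFin n) (λ v A → (v ∈? B) ×-dec at? v A) F
                                                                (λ {A} _ (p , m) → case meet⁻ B A m of λ where
                                                                  (v , v∈B , v∈A) → v , Mem.∈-allFin v , v∈B , p , v∈A) ⟩
      ∑ (allFin n) (λ v → # (λ A → (v ∈? B) ×-dec at? v A) F) ≤⟨ ∑-mono (allFin n) (λ {v} _ → point v) ⟩
      ∑ (allFin n) (λ v → ind (v ∈? B) * E)                ≡⟨ ∑-distribʳ-* (allFin n) (λ v → ind (v ∈? B)) E ⟩
      # (_∈? B) (allFin n) * E                             ≡⟨ cong (_* E) (trans (sym (∣p∣≡# B)) (uniform (proj₁ (Bs⊆ B∈)))) ⟩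
      k * E                                                ∎
      where
      point : ∀ v → # (λ A → (v ∈? B) ×-dec at? v A) F ≤ ind (v ∈? B) * E
      point v with v ∈? B in eq
      ... | yes v∈ = subst (_≤ _) (#-cong (at? v) (λ A → yes v∈ ×-dec at? v A) F (λ _ p → v∈ , p) (λ _ → proj₂))
                       (≤-trans (local (proj₁ (Bs⊆ B∈)) (proj₂ (Bs⊆ B∈)) v∈) (≤-reflexive (sym (+-identityʳ E))))
      ... | no v∉ = ≤-reflexive (#-none (λ A → no v∉ ×-dec at? v A) F λ _ (v∈ , _) → v∉ v∈)

-- Arithmetic of binomial coefficients and of mfun

mfun*≤ : ∀ k s b → mfun k s b * suc b ≤ (s + b) * k
mfun*≤ k s b = m/n*n≤m ((s + b) * k) (suc b)

mfun-greatest : ∀ k s b {M} → M * suc b ≤ (s + b) * k → M ≤ mfun k s b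
mfun-greatest k s b {M} h = ≤-trans (≤-reflexive (sym (m*n/n≡m M (suc b)))) (/-monoˡ-≤ (suc b) h)

<suc-mfun* : ∀ k s b → (s + b) * k < suc (mfun k s b) * suc b
<suc-mfun* k s b = ≰⇒> λ h → <-irrefl refl (mfun-greatest k s b h)

k≤mfun : ∀ k s b → 1 ≤ s → k ≤ mfun k s b
k≤mfun k (suc s) b _ = mfun-greatest k (suc s) b
  (≤-trans (≤-reflexive (*-comm k (suc b))) (*-monoˡ-≤ k (s≤s (m≤n+m b s))))

-- Passing from b = β + d back to β lowers the left side of M(b + 1) ≤ (s + b)k by dM and the right
-- side by dk, and M ≥ k because s ≥ 1.
mfun-antitone : ∀ k s {β b} → 1 ≤ s → β ≤ b → mfun k s b ≤ mfun k s β
mfun-antitone k s {β} {b} 1≤s β≤b with m≤n⇒∃[o]m+o≡n β≤b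
... | d , refl = mfun-greatest k s β (+-cancelʳ-≤ (d * k) (M * suc β) ((s + β) * k) (begin
  M * suc β + d * k      ≤⟨ +-monoʳ-≤ (M * suc β) (*-monoʳ-≤ d (k≤mfun k s (β + d) 1≤s)) ⟩
  M * suc β + d * M      ≡⟨ e₁ M β d ⟩
  M * suc (β + d)        ≤⟨ mfun*≤ k s (β + d) ⟩
  (s + (β + d)) * k      ≡⟨ e₂ s β d k ⟩
  (s + β) * k + d * k    ∎))
  where
  open ≤-Reasoning
  M = mfun k s (β + d)
  e₁ : ∀ M β d → M * suc β + d * M ≡ M * suc (β + d)
  e₁ = solve-∀
  e₂ : ∀ s β d k → (s + (β + d)) * k ≡ (s + β) * k + d * k
  e₂ = solve-∀

pascal : ∀ n r → suc n C suc r ≡ n C r + n C suc r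
pascal n r = sym (nCk+nC[k+1]≡[n+1]C[k+1] n r)

-- The absorption identity, by induction through Pascal's rule.
C-absorb : ∀ n r → suc r * (suc n C suc r) ≡ suc n * (n C r)
C-absorb n zero = begin
  1 * (suc n C 1)   ≡⟨ *-identityˡ _ ⟩
  suc n C 1         ≡⟨ nC1≡n (suc n) ⟩
  suc n             ≡⟨ *-identityʳ (suc n) ⟨
  suc n * 1         ≡⟨ cong (suc n *_) (nC0≡1 n) ⟨
  suc n * (n C 0)   ∎
  where open ≡-Reasoning
C-absorb zero (suc r) = trans (cong (suc (suc r) *_) (k>n⇒nCk≡0 {1} {suc (suc r)} (s≤s (s≤s z≤n))))
  (trans (*-zeroʳ (suc (suc r))) (sym (cong (1 *_) (k>n⇒nCk≡0 {0} {suc r} (s≤s z≤n)))))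
C-absorb (suc n) (suc r) = begin
  suc (suc r) * (suc (suc n) C suc (suc r))                ≡⟨ cong (suc (suc r) *_) (pascal (suc n) (suc r)) ⟩
  suc (suc r) * (x + suc n C suc (suc r))                  ≡⟨ e₁ (suc r) x (suc n C suc (suc r)) ⟩
  suc r * x + suc (suc r) * (suc n C suc (suc r)) + x      ≡⟨ cong (_+ x) (cong₂ _+_ (C-absorb n r) (C-absorb n (suc r))) ⟩
  suc n * (n C r) + suc n * (n C suc r) + x                ≡⟨ cong (_+ x) (*-distribˡ-+ (suc n) (n C r) (n C suc r)) ⟨
  suc n * (n C r + n C suc r) + x                          ≡⟨ cong (λ y → suc n * y + x) (pascal n r) ⟨
  suc n * x + x                                            ≡⟨ +-comm (suc n * x) x ⟩
  suc (suc n) * x                                          ∎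
  where
  open ≡-Reasoning
  x = suc n C suc r
  e₁ : ∀ r x y → suc r * (x + y) ≡ r * x + suc r * y + x
  e₁ = solve-∀

C-pos : ∀ {n r} → r ≤ n → 1 ≤ n C r
C-pos {n}     {zero}  _       = ≤-reflexive (sym (nC0≡1 n))
C-pos {suc n} {suc r} (s≤s h) = ≤-trans (C-pos h) (≤-trans (m≤m+n _ _) (≤-reflexive (sym (pascal n r))))

-- The quotient of the two coefficients is (n - r)/(r + 1), which exceeds `K` under this hypothesis;
-- `C-absorb` replaces the division.
C-ratio : ∀ {n r} K → r + suc r * K < n → K * (n C r) < n C suc r
C-ratio {n} {r} K h = ≰⇒> λ le → <⇒≱ h (*-cancelʳ-≤ n (r + suc r * K) (n C r) {{>-nonZero pos}} (begin
  n * (n C r)                               ≤⟨ +-cancelʳ-≤ (n C r) _ _ (begin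
    n * c + c                                 ≡⟨ +-comm (n * c) c ⟩
    suc n * c                                 ≡⟨ C-absorb n r ⟨
    suc r * (suc n C suc r)                   ≡⟨ cong (suc r *_) (pascal n r) ⟩
    suc r * (c + n C suc r)                   ≤⟨ *-monoʳ-≤ (suc r) (+-monoʳ-≤ c le) ⟩
    suc r * (c + K * c)                       ≡⟨ e₁ r c K ⟩
    (r + suc r * K) * c + c                   ∎) ⟩
  (r + suc r * K) * (n C r)                 ∎))
  where
  open ≤-Reasoning
  c = n C r
  pos : 1 ≤ n C r
  pos = C-pos (≤-trans (m≤m+n r _) (<⇒≤ h))
  e₁ : ∀ r c K → suc r * (c + K * c) ≡ (r + suc r * K) * c + c
  e₁ = solve-∀

-- Each of the `j` Pascal steps adds one coefficient with lower index `r`, at most `(j + n) C r`. In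
-- `C-shift≥` the same coefficients are bounded below by `n C r`.
C-shift≤ : ∀ j n r → (j + n) C suc r ≤ n C suc r + j * ((j + n) C r)
C-shift≤ zero    n r = ≤-reflexive (sym (+-identityʳ _))
C-shift≤ (suc j) n r = begin
  suc (j + n) C suc r                                  ≡⟨ pascal (j + n) r ⟩
  (j + n) C r + (j + n) C suc r                        ≤⟨ +-monoʳ-≤ _ (C-shift≤ j n r) ⟩
  (j + n) C r + (n C suc r + j * ((j + n) C r))        ≡⟨ e₁ ((j + n) C r) (n C suc r) j ⟩
  n C suc r + suc j * ((j + n) C r)                    ≤⟨ +-monoʳ-≤ (n C suc r) (*-monoʳ-≤ (suc j) (C-suc-mono (j + n) r)) ⟩
  n C suc r + suc j * (suc (j + n) C r)                ∎
  where
  open ≤-Reasoning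
  e₁ : ∀ x y j → x + (y + j * x) ≡ y + suc j * x
  e₁ = solve-∀

C-shift≥ : ∀ j n r → j * (n C r) + n C suc r ≤ (j + n) C suc r
C-shift≥ zero    n r = ≤-refl
C-shift≥ (suc j) n r = begin
  n C r + j * (n C r) + n C suc r          ≡⟨ +-assoc (n C r) _ _ ⟩
  n C r + (j * (n C r) + n C suc r)        ≤⟨ +-mono-≤ (C-mono-+ j n r) (C-shift≥ j n r) ⟩
  (j + n) C r + (j + n) C suc r            ≡⟨ pascal (j + n) r ⟨
  suc (j + n) C suc r                      ∎
  where open ≤-Reasoning

-- Read off from `few-pairs-bound`: the summand `suc m` leaves room for `m + 1` leaves beside the
-- centre, and the remainder is the hypothesis of `C-ratio` for the constant `L` used there.
threshold : ℕ → ℕ → ℕ → ℕ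
threshold r m K = suc (suc m + (r + suc r * (m * suc (suc m) + K + suc (suc m))))

-- With k = r + 3, the right side counts the k-sets through a point that meet `m + 1` further
-- points, and is at least m + 1 times `X`, the coefficient at n - (m + 1). The left side is at most
-- m times `X` plus terms with lower index `r`, and the one spare copy of `X` exceeds those.
few-pairs-bound : ∀ r m K n → threshold r m K ≤ suc n →
  m * (suc n C suc r) + K * (suc n C r) < (suc n ∸ 1) C suc (suc r) ∸ (suc n ∸ suc m ∸ 1) C suc (suc r)
few-pairs-bound r m K n large with m≤n⇒∃[o]m+o≡n {suc m} {n} (≤-trans (m≤m+n (suc m) _) (≤-pred large))
... | n′ , refl = begin-strict
  m * (N C suc r) + K * Y                    ≤⟨ +-monoˡ-≤ (K * Y) (*-monoʳ-≤ m (C-shift≤ (suc (suc m)) n′ r)) ⟩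
  m * (X + suc (suc m) * Y) + K * Y          ≡⟨ e₁ m X (suc (suc m)) Y K ⟩
  m * X + (m * suc (suc m) + K) * Y          <⟨ +-monoʳ-< (m * X) rest ⟩
  m * X + X                                  ≡⟨ +-comm (m * X) X ⟩
  suc m * X                                  ≡⟨ m+n∸n≡m (suc m * X) Z ⟨
  suc m * X + Z ∸ Z                          ≤⟨ ∸-monoˡ-≤ Z (C-shift≥ (suc m) n′ (suc r)) ⟩
  (suc m + n′) C suc (suc r) ∸ Z             ≡⟨ cong (λ x → (suc m + n′) C suc (suc r) ∸ x C suc (suc r)) n′≡ ⟨
  (suc m + n′) C suc (suc r) ∸ (N ∸ suc m ∸ 1) C suc (suc r) ∎
  where
  open ≤-Reasoning
  N = suc (suc m + n′)
  L = m * suc (suc m) + K + suc (suc m)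
  X = n′ C suc r
  Y = N C r
  Z = n′ C suc (suc r)
  e₁ : ∀ m X l Y K → m * (X + l * Y) + K * Y ≡ m * X + (m * l + K) * Y
  e₁ = solve-∀
  n′≡ : N ∸ suc m ∸ 1 ≡ n′
  n′≡ = trans (cong (_∸ 1) (trans (cong (_∸ suc m) (sym (+-suc (suc m) n′))) (m+n∸m≡n (suc m) (suc n′)))) refl
  -- The last summand `suc (suc m)` of `L` pays for replacing `N C suc r` by `X`.
  rest : (m * suc (suc m) + K) * Y < X
  rest = +-cancelʳ-< (suc (suc m) * Y) _ _ (begin-strict
    (m * suc (suc m) + K) * Y + suc (suc m) * Y ≡⟨ *-distribʳ-+ Y (m * suc (suc m) + K) (suc (suc m)) ⟨
    L * Y                                       <⟨ C-ratio {N} {r} L (≤-trans (m≤n+m _ (suc m)) (≤-trans (≤-reflexive (+-suc (suc m) _)) large)) ⟩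
    N C suc r                                   ≤⟨ C-shift≤ (suc (suc m)) n′ r ⟩
    X + suc (suc m) * Y                         ∎)

-- Incidences between a family and a set of points of high degree

module Incidence {n : ℕ} (k : ℕ) (Bs : List (Subset n)) (uniform : ∀ {B} → B ∈ₗ Bs → ∣ B ∣ ≡ k) where

  -- Double counting of the pairs y ∈ B: each point of `S` accounts for at least `suc b` of them,
  -- and each `B` with `R` for at least one more, at a point outside `S`.
  incidence : ∀ (S : Subset n) b → (∀ {y} → y ∈ S → suc b ≤ # (y ∈?_) Bs) →
              {R : Pred (Subset n) 0ℓ} (R? : Decidable R) → (∀ {B} → B ∈ₗ Bs → R B → ∃[ y ] y ∈ B × y ∉ S) →
              ∣ S ∣ * suc b + # R? Bs ≤ length Bs * k
  incidence S b deg R? out = begin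
    ∣ S ∣ * suc b + # R? Bs
      ≤⟨ +-mono-≤ (≤-reflexive (trans (cong (_* suc b) (∣p∣≡# S)) (sym (∑-distribʳ-* (allFin n) (λ y → ind (y ∈? S)) (suc b)))))
                  (#-⋃ R? (allFin n) outside? Bs (λ i r → case out i r of λ { (y , y∈ , y∉) → y , Mem.∈-allFin y , y∈ , y∉ })) ⟩
    ∑ (allFin n) (λ y → ind (y ∈? S) * suc b) + ∑ (allFin n) (λ y → # (outside? y) Bs)
      ≡⟨ ∑-distrib-+ (allFin n) _ _ ⟨
    ∑ (allFin n) (λ y → ind (y ∈? S) * suc b + # (outside? y) Bs)
      ≤⟨ ∑-mono (allFin n) (λ {y} _ → point y) ⟩
    ∑ (allFin n) (λ y → # (y ∈?_) Bs)
      ≡⟨ ∑-swap (allFin n) Bs (λ y B → ind (y ∈? B)) ⟩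
    ∑ Bs (λ B → # (_∈? B) (allFin n))
      ≤⟨ ∑-≤ Bs (λ {B} i → ≤-reflexive (trans (sym (∣p∣≡# B)) (uniform i))) ⟩
    length Bs * k ∎
    where
    open ≤-Reasoning
    outside? = λ y B → (y ∈? B) ×-dec ¬? (y ∈? S)
    point : ∀ y → ind (y ∈? S) * suc b + # (outside? y) Bs ≤ # (y ∈?_) Bs
    point y with y ∈? S
    ... | yes y∈ = subst₂ (λ u v → u + v ≤ # (y ∈?_) Bs) (sym (*-identityˡ (suc b)))
                     (sym (#-none (λ B → (y ∈? B) ×-dec ¬? (yes y∈)) Bs λ _ (_ , y∉) → y∉ y∈))
                     (≤-trans (≤-reflexive (+-identityʳ (suc b))) (deg y∈))
    ... | no y∉ = #-mono (λ B → (y ∈? B) ×-dec ¬? (no y∉)) (y ∈?_) Bs (λ _ → proj₁)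

  high-degree≤ : ∀ (S : Subset n) b → (∀ {y} → y ∈ S → suc b ≤ # (y ∈?_) Bs) → ∣ S ∣ * suc b ≤ length Bs * k
  high-degree≤ S b deg = ≤-trans (m≤m+n _ _)
    (incidence S b deg (λ B → meet? B (∁ S)) λ {B} _ m → case meet⁻ B (∁ S) m of λ where
      (y , y∈ , y∈′) → y , y∈ , x∈∁p⇒x∉p y∈′)

  module Tight (s b : ℕ) (len : length Bs ≡ s + b) (S : Subset n) (deg : ∀ {y} → y ∈ S → suc b ≤ # (y ∈?_) Bs)
               (tight : (s + b) * k < suc ∣ S ∣ * suc b) where

    -- The points of S absorb all but at most b of the (s + b)k incidences.
    outside≤ : {R : Pred (Subset n) 0ℓ} (R? : Decidable R) → (∀ {B} → B ∈ₗ Bs → R B → ∃[ y ] y ∈ B × y ∉ S) →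
               # R? Bs ≤ b
    outside≤ R? out = ≤-pred (+-cancelʳ-< (∣ S ∣ * suc b) (# R? Bs) (suc b) (begin-strict
      # R? Bs + ∣ S ∣ * suc b   ≡⟨ +-comm (# R? Bs) _ ⟩
      ∣ S ∣ * suc b + # R? Bs   ≤⟨ incidence S b deg R? out ⟩
      length Bs * k            ≡⟨ cong (_* k) len ⟩
      (s + b) * k              <⟨ tight ⟩
      suc ∣ S ∣ * suc b         ∎))
      where open ≤-Reasoning

    compl≥s : {R : Pred (Subset n) 0ℓ} (R? : Decidable R) → # R? Bs ≤ b → s ≤ # (λ B → ¬? (R? B)) Bs
    compl≥s R? h = +-cancelˡ-≤ b s _ (begin
      b + s                                   ≡⟨ +-comm b s ⟩
      s + b                                   ≡⟨ len ⟨
      length Bs                               ≡⟨ #-compl R? Bs ⟨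
      # R? Bs + # (λ B → ¬? (R? B)) Bs        ≤⟨ +-monoˡ-≤ _ h ⟩
      b + # (λ B → ¬? (R? B)) Bs              ∎)
      where open ≤-Reasoning

    compl<s : {R : Pred (Subset n) 0ℓ} (R? : Decidable R) → suc b ≤ # R? Bs → # (λ B → ¬? (R? B)) Bs < s
    compl<s R? h = +-cancelˡ-≤ b _ s (begin
      b + suc (# (λ B → ¬? (R? B)) Bs)        ≡⟨ +-suc b _ ⟩
      suc b + # (λ B → ¬? (R? B)) Bs          ≤⟨ +-monoˡ-≤ _ h ⟩
      # R? Bs + # (λ B → ¬? (R? B)) Bs        ≡⟨ #-compl R? Bs ⟩
      length Bs                               ≡⟨ len ⟩
      s + b                                   ≡⟨ +-comm s b ⟩
      b + s                                   ∎)
      where open ≤-Reasoning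

    -- A point of `A` in `S` lies in at least b + 1 of the s + b sets, so at most s - 1 of them are
    -- disjoint from `A`. Together with `miss⇒s≤disjoint` this identifies S_1(A_1, ..., A_p : s)
    -- with the k-sets through 1 that meet `S`.
    hit⇒disjoint<s : ∀ {A} → Nonempty (A ∩ S) → # (λ B → ¬? (meet? A B)) Bs < s
    hit⇒disjoint<s {A} hit = compl<s (meet? A) (case meet⁻ A S hit of λ where
      (y , y∈A , y∈S) → ≤-trans (deg y∈S) (#-mono (y ∈?_) (meet? A) Bs λ _ → meet⁺ y∈A))

    -- A set `B` that meets such an `A` does so outside `S`, and at most `b` of the s + b sets have
    -- a point there.
    miss⇒s≤disjoint : ∀ {A} → ¬ Nonempty (A ∩ S) → s ≤ # (λ B → ¬? (meet? A B)) Bs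
    miss⇒s≤disjoint {A} miss = compl≥s (meet? A) (outside≤ (meet? A) λ {B} _ m → case meet⁻ A B m of λ where
      (y , y∈A , y∈B) → y , y∈B , λ y∈S → miss (meet⁺ y∈A y∈S))

    s≤inside : s ≤ # (λ B → ¬? (meet? B (∁ S))) Bs
    s≤inside = compl≥s (λ B → meet? B (∁ S)) (outside≤ (λ B → meet? B (∁ S)) λ {B} _ m → case meet⁻ B (∁ S) m of λ where
      (y , y∈B , y∈′) → y , y∈B , x∈∁p⇒x∉p y∈′)

    -- A point outside `S` can lie in at most `b` of the sets by `outside≤`. With `deg` this makes
    -- `S` exactly the set T.
    high-degree⇒∈ : ∀ {y} → suc b ≤ # (y ∈?_) Bs → y ∈ S
    high-degree⇒∈ {y} h = case y ∈? S of λ where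
      (yes y∈) → y∈
      (no y∉)  → contradiction (outside≤ (y ∈?_) λ _ y∈ → y , y∈ , y∉) (<⇒≱ h)

¬meet-∁⇒⊆ : (B S : Subset n) → ¬ Nonempty (B ∩ ∁ S) → B ⊆ S
¬meet-∁⇒⊆ B S ¬m {y} y∈ = case y ∈? S of λ where
  (yes y∈S) → y∈S
  (no y∉S)  → contradiction (meet⁺ y∈ (x∉p⇒x∈∁p y∉S)) ¬m

-- Translation of `disjointCount` and `T` into counts over lists

countTrue≡# : ∀ {p} (a : Fin p → A) {P : Pred A 0ℓ} (P? : Decidable P) (f : Fin p → Bool) →
              (∀ i → f i ≡ does (P? (a i))) → countTrue f ≡ # P? (tabulate a)
countTrue≡# {p = zero}  a P? f h = refl
countTrue≡# {p = suc p} a P? f h =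
  cong₂ _+_ (cong (λ x → if x then 1 else 0) (h zero)) (countTrue≡# (a ∘ suc) P? (f ∘ suc) (h ∘ suc))

disjointCount≡# : ∀ {p} (A : Subset n) (a : Fin p → Subset n) →
                  disjointCount A a ≡ # (λ B → ¬? (meet? A B)) (tabulate a)
disjointCount≡# {n} A a = countTrue≡# a (λ B → ¬? (meet? A B)) (λ i → ∣ A ∩ a i ∣ ≡ᵇ 0) λ i → reflects (A ∩ a i)
  where
  reflects : ∀ X → (∣ X ∣ ≡ᵇ 0) ≡ does (¬? (nonempty? X))
  reflects X with nonempty? X
  ... | yes (y , y∈) = aux (≤-trans (≤-reflexive (sym (∣⁅x⁆∣≡1 y))) (p⊆q⇒∣p∣≤∣q∣ (⁅i⁆⊆ y∈)))
    where
    aux : ∀ {x} → 1 ≤ x → (x ≡ᵇ 0) ≡ false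
    aux (s≤s _) = refl
  ... | no ¬ne = cong (_≡ᵇ 0) (trans (cong ∣_∣ (Empty-unique ¬ne)) (∣⊥∣≡0 n))

does-∈? : ∀ y (X : Subset n) → lookupᵥ X y ≡ does (y ∈? X)
does-∈? y X with y ∈? X
... | yes y∈ = Vec.[]=⇒lookup y∈
... | no y∉ with lookupᵥ X y in eq
...   | true  = contradiction (Vec.lookup⇒[]= y X eq) y∉
...   | false = refl

∈T⁺ : ∀ {p} (a : Fin p → Subset n) s {y} → p ∸ s + 1 ≤ # (y ∈?_) (tabulate a) → y ∈ T a s
∈T⁺ a s {y} h = Vec.lookup⇒[]= y (T a s) (trans (Vec.lookup∘tabulate _ y)
  (T⇒≡ (≤⇒≤ᵇ (subst (_ ≤_) (sym (countTrue≡# a (y ∈?_) (λ i → lookupᵥ (a i) y) λ i → does-∈? y (a i))) h))))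
  where
  T⇒≡ : ∀ {x} → Data.Bool.T x → x ≡ true
  T⇒≡ {true} _ = refl

∈T⁻ : ∀ {p} (a : Fin p → Subset n) s {y} → y ∈ T a s → p ∸ s + 1 ≤ # (y ∈?_) (tabulate a)
∈T⁻ a s {y} y∈ = subst (_ ≤_) (countTrue≡# a (y ∈?_) (λ i → lookupᵥ (a i) y) λ i → does-∈? y (a i))
  (≤ᵇ⇒≤ _ _ (subst Data.Bool.T (sym (trans (sym (Vec.lookup∘tabulate _ y)) (Vec.[]=⇒lookup y∈))) _))

-- Extremal families

#-filter : {P Q : Pred A 0ℓ} (P? : Decidable P) (Q? : Decidable Q) (xs : List A) →
           # P? (filter Q? xs) ≡ # (λ x → Q? x ×-dec P? x) xs
#-filter P? Q? []       = refl
#-filter P? Q? (x ∷ xs) with Q? x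
... | yes q with P? x
...   | yes _ = cong suc (#-filter P? Q? xs)
...   | no  _ = #-filter P? Q? xs
#-filter P? Q? (x ∷ xs) | no _ = #-filter P? Q? xs

s+b∸s+1≡ : ∀ s b → s + b ∸ s + 1 ≡ suc b
s+b∸s+1≡ s b = trans (cong (_+ 1) (m+n∸m≡n s b)) (+-comm b 1)

∈image⁺ : (σ : Permutation′ n) (A : Subset n) {y : Fin n} → σ ⟨$⟩ˡ y ∈ A → y ∈ image σ A
∈image⁺ σ A {y} h = Vec.lookup⇒[]= y _ (trans (Vec.lookup∘tabulate _ y) (Vec.[]=⇒lookup h))

∈image⁻ : (σ : Permutation′ n) (A : Subset n) {y : Fin n} → y ∈ image σ A → σ ⟨$⟩ˡ y ∈ A
∈image⁻ σ A {y} h = Vec.lookup⇒[]= (σ ⟨$⟩ˡ y) A (trans (sym (Vec.lookup∘tabulate _ y)) (Vec.[]=⇒lookup h))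

image-flip : (σ : Permutation′ n) (A : Subset n) → image (flip σ) (image σ A) ≡ A
image-flip σ A = ⊆-antisym
  (λ {y} h → subst (_∈ A) (inverseˡ σ) (∈image⁻ σ A (∈image⁻ (flip σ) (image σ A) h)))
  (λ {y} h → ∈image⁺ (flip σ) (image σ A) (∈image⁺ σ A (subst (_∈ A) (sym (inverseˡ σ)) h)))

image-unflip : (σ : Permutation′ n) (A : Subset n) → image σ (image (flip σ) A) ≡ A
image-unflip σ A = ⊆-antisym
  (λ {y} h → subst (_∈ A) (inverseʳ σ) (∈image⁻ (flip σ) A (∈image⁻ σ (image (flip σ) A) h)))
  (λ {y} h → ∈image⁺ σ (image (flip σ) A) (∈image⁺ (flip σ) A (subst (_∈ A) (sym (inverseʳ σ)) h)))

image-injective : (σ : Permutation′ n) {A B : Subset n} → image σ A ≡ image σ B → A ≡ B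
image-injective σ {A} {B} e = trans (sym (image-flip σ A)) (trans (cong (image (flip σ)) e) (image-flip σ B))

image-id : (A : Subset n) → image Perm.id A ≡ A
image-id = Vec.tabulate∘lookup

∉⇒lookup≡false : {X : Subset n} {y : Fin n} → y ∉ X → lookupᵥ X y ≡ false
∉⇒lookup≡false {X = X} {y} y∉ with lookupᵥ X y in eq
... | true  = contradiction (Vec.lookup⇒[]= y X eq) y∉
... | false = refl

lookup≡false⇒∉ : {X : Subset n} {y : Fin n} → lookupᵥ X y ≡ false → y ∉ X
lookup≡false⇒∉ e y∈ = case trans (sym e) (Vec.[]=⇒lookup y∈) of λ ()

-- The truncated `∸ 1` in `bound` can be taken from `t`, as t ≥ 1; the rest splits into the three
-- classes of members counted later.
bound≡ : ∀ D s t b → 1 ≤ t → D + s + t + b ∸ 1 ≡ D + ((t ∸ 1) + (s + b))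
bound≡ D s (suc t) b _ = trans (cong (_∸ 1) (e D s t b)) refl
  where
  e : ∀ D s t b → D + s + suc t + b ≡ suc (D + (t + (s + b)))
  e = solve-∀

module _ {n : ℕ} (k s t m b : ℕ) (1≤k : 1 ≤ k) (1≤t : 1 ≤ t) (m≡ : mfun k s b ≡ m) where

  private
    p = s + b

  -- Up to the permutation, `F` is the disjoint union of the k-sets through 1 that meet T and of the
  -- p + t - 1 sets listed by `c`.
  extremal⇒size : {F : List (Subset (suc n))} → Unique F → IsExtremal k s t m p F →
                  length F ≡ bound (suc n) k m s t b
  extremal⇒size {F} uF (c , c-inj , card , A∌1 , ∣T∣≡m , F∈S1 , _ , σ , mem) = begin
    length F                     ≡⟨ List.length-map (image σ) F ⟨
    length F′                    ≡⟨ ≤-antisym (Unique-⊆⇒length≤ _≟ₛ_ uF′ F′⊆E) (Unique-⊆⇒length≤ _≟ₛ_ uE E⊆F′) ⟩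
    length E                     ≡⟨ List.length-++ H ⟩
    length H + length (tabulate c) ≡⟨ cong₂ _+_ (sym (#≡length-filter (starHit? k S) (cube (suc n)))) (List.length-tabulate c) ⟩
    # (starHit? k S) (cube (suc n)) + (p + (t ∸ 1)) ≡⟨ cong₂ _+_ (trans (#-starHit k S 1≤k 0∉S) (cong D ∣T∣≡m)) (+-comm p (t ∸ 1)) ⟩
    D m + ((t ∸ 1) + p)          ≡⟨ bound≡ (D m) s t b 1≤t ⟨
    bound (suc n) k m s t b      ∎
    where
    open ≡-Reasoning
    a = Aset k s t m p c
    f = Fset k s t m p c
    Bs = tabulate a
    S = T a s
    D : ℕ → ℕ
    D m = (suc n ∸ 1) C (k ∸ 1) ∸ (suc n ∸ m ∸ 1) C (k ∸ 1)
    uniB : ∀ {B} → B ∈ₗ Bs → ∣ B ∣ ≡ k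
    uniB B∈ with Mem.∈-tabulate⁻ B∈
    ... | i , refl = card (i ↑ˡ (t ∸ 1))
    deg : ∀ {y} → y ∈ S → suc b ≤ # (y ∈?_) Bs
    deg {y} y∈ = subst (_≤ # (y ∈?_) Bs) (s+b∸s+1≡ s b) (∈T⁻ a s y∈)
    open Incidence k Bs uniB
    -- T has size `mfun k s b`, so fewer than b + 1 incidences remain outside it.
    open Tight s b (List.length-tabulate a) S deg
      (subst (λ m → (s + b) * k < suc m * suc b) (trans m≡ (sym ∣T∣≡m)) (<suc-mfun* k s b))
    0∉B : ∀ {B} → B ∈ₗ Bs → zero ∉ B
    0∉B B∈ with Mem.∈-tabulate⁻ B∈
    ... | i , refl = lookup≡false⇒∉ (A∌1 i)
    0∉S : zero ∉ S
    0∉S 0∈ = contradiction (≤-trans (deg 0∈) (≤-reflexive (#-none (zero ∈?_) Bs 0∉B))) λ ()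
    hit⇒S1A : ∀ {A} → StarHit k S A → InS1A k a s A
    hit⇒S1A {A} (c , 0∈ , h) = (c , Vec.[]=⇒lookup 0∈) , subst (_< s) (sym (disjointCount≡# A a)) (hit⇒disjoint<s h)
    S1A⇒hit : ∀ {A} → InS1A k a s A → StarHit k S A
    S1A⇒hit {A} ((c , 0∈) , d) = c , Vec.lookup⇒[]= zero A 0∈ , (case meet? A S of λ where
      (yes h) → h
      (no ¬h) → contradiction (subst (_< s) (disjointCount≡# A a) d) (≤⇒≯ (miss⇒s≤disjoint ¬h)))
    H = filter (starHit? k S) (cube (suc n))
    E = H ++ tabulate c
    F′ = map (image σ) F
    uF′ : Unique F′
    uF′ = Unique.map⁺ (image-injective σ) uF
    split : ∀ i → (∃[ j ] c i ≡ a j) ⊎ (∃[ j ] c i ≡ f j)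
    split i with splitAt p i in eq
    ... | inj₁ j = inj₁ (j , cong c (sym (Fin.splitAt⁻¹-↑ˡ eq)))
    ... | inj₂ j = inj₂ (j , cong c (sym (Fin.splitAt⁻¹-↑ʳ eq)))
    -- A set of `H` contains 1, unlike the A_i, and lies in S_1(A_1, ..., A_p : s), unlike the F_j.
    H#c : Disjoint H (tabulate c)
    H#c {X} (X∈H , X∈c) with Mem.∈-filter⁻ (starHit? k S) {xs = cube (suc n)} X∈H | Mem.∈-tabulate⁻ X∈c
    ... | _ , h | i , refl with split i
    ...   | inj₁ (j , e) = 0∉B (Mem.∈-tabulate⁺ j) (subst (zero ∈_) e (proj₁ (proj₂ h)))
    ...   | inj₂ (j , e) = proj₂ (F∈S1 j) (subst (InS1A k a s) e (hit⇒S1A h))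
    uE : Unique E
    uE = Unique.++⁺ (Unique.filter⁺ (starHit? k S) (cube-unique (suc n))) (Unique.tabulate⁺ c-inj) H#c
    F′⊆E : ∀ {X} → X ∈ₗ F′ → X ∈ₗ E
    F′⊆E X∈ with Mem.∈-map⁻ (image σ) X∈
    ... | A , A∈ , refl with proj₁ (mem A) A∈
    ...   | inj₁ s1a = Mem.∈-++⁺ˡ (Mem.∈-filter⁺ (starHit? k S) (∈-cube _) (S1A⇒hit s1a))
    ...   | inj₂ (inj₁ (i , e)) = Mem.∈-++⁺ʳ H (subst (_∈ₗ tabulate c) (sym e) (Mem.∈-tabulate⁺ _))
    ...   | inj₂ (inj₂ (j , e)) = Mem.∈-++⁺ʳ H (subst (_∈ₗ tabulate c) (sym e) (Mem.∈-tabulate⁺ _))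
    ext⇒F′ : ∀ {X} → InExtremal k s t m p c X → X ∈ₗ F′
    ext⇒F′ {X} h = subst (_∈ₗ F′) (image-unflip σ X) (Mem.∈-map⁺ (image σ)
      (proj₂ (mem (image (flip σ) X)) (subst (InExtremal k s t m p c) (sym (image-unflip σ X)) h)))
    E⊆F′ : ∀ {X} → X ∈ₗ E → X ∈ₗ F′
    E⊆F′ X∈ with Mem.∈-++⁻ H X∈
    ... | inj₁ X∈H = ext⇒F′ (inj₁ (hit⇒S1A (proj₂ (Mem.∈-filter⁻ (starHit? k S) {xs = cube (suc n)} X∈H))))
    ... | inj₂ X∈c with Mem.∈-tabulate⁻ X∈c
    ...   | i , refl = ext⇒F′ (inj₂ (split i))


-- Families with a star centred at 1: size and equality

squeeze : ∀ {a b A B} → a ≤ A → b ≤ B → A + B ≤ a + b → a ≡ A × b ≡ B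
squeeze {a} {b} {A} {B} a≤ b≤ h =
    ≤-antisym a≤ (+-cancelʳ-≤ B A a (≤-trans h (+-monoʳ-≤ a b≤)))
  , ≤-antisym b≤ (+-cancelˡ-≤ A B b (≤-trans h (+-monoˡ-≤ b a≤)))

enumerate : ∀ {q} (xs : List A) → length xs ≡ q → ∃[ a ] tabulate {n = q} a ≡ xs
enumerate xs refl = lookup xs , List.tabulate-lookup xs

tabulate-unique⇒injective : ∀ {q} (a : Fin q → A) → Unique (tabulate a) → Injective _≡_ _≡_ a
tabulate-unique⇒injective a (x∉ ∷ u) {zero}  {zero}  e = refl
tabulate-unique⇒injective a (x∉ ∷ u) {zero}  {suc j} e = contradiction e (All.lookup x∉ (Mem.∈-tabulate⁺ j))
tabulate-unique⇒injective a (x∉ ∷ u) {suc i} {zero}  e = contradiction (sym e) (All.lookup x∉ (Mem.∈-tabulate⁺ i))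
tabulate-unique⇒injective a (x∉ ∷ u) {suc i} {suc j} e = cong suc (tabulate-unique⇒injective (a ∘ suc) u e)

-- Of heaviness only `avoid<s` is kept: fewer than `s` members avoid both the centre and a given
-- leaf.
module Star {n : ℕ} (k s t β β̂ : ℕ) (1≤k : 1 ≤ k) (1≤s : 1 ≤ s) (1≤t : 1 ≤ t) (isβ̂ : IsBetaHat k s β β̂)
            (F : List (Subset (suc n))) (unique : Unique F) (uniform : ∀ {A} → A ∈ₗ F → ∣ A ∣ ≡ k)
            (ui : UnionIntersecting s t F)
            (avoid0≥ : s + β ≤ # (λ A → ¬? (zero ∈? A)) F)
            (S : Subset (suc n)) (0∉S : zero ∉ S) (m≤∣S∣ : mfun k s β ≤ ∣ S ∣)
            (avoid<s : ∀ {y} → y ∈ S → # (λ A → ¬? (zero ∈? A) ×-dec ¬? (y ∈? A)) F < s) where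

  open UniformFamily k s t 1≤k F unique uniform ui
  private
    m = mfun k s β
    avoid? : Decidable {A = Subset (suc n)} (λ A → ¬ (zero ∈ A))
    avoid? A = ¬? (zero ∈? A)
    Bs = filter avoid? F
    D = (suc n ∸ 1) C (k ∸ 1) ∸ (suc n ∸ m ∸ 1) C (k ∸ 1)

    Bs⊆F : ∀ {B} → B ∈ₗ Bs → B ∈ₗ F
    Bs⊆F B∈ = proj₁ (Mem.∈-filter⁻ avoid? {xs = F} B∈)

    uBs : Unique Bs
    uBs = Unique.filter⁺ avoid? unique

    -- Defines `b` by writing the number of members that avoid 1 as s + b.
    excess : ∃[ b ] s + b ≡ length Bs × β ≤ b
    excess with m≤n⇒∃[o]m+o≡n (≤-trans avoid0≥ (≤-reflexive (#≡length-filter avoid? F)))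
    ... | d , e = β + d , trans (sym (+-assoc s β d)) e , m≤m+n β d

    b = proj₁ excess
    lenB : length Bs ≡ s + b
    lenB = sym (proj₁ (proj₂ excess))
    β≤b : β ≤ b
    β≤b = proj₂ (proj₂ excess)

    missB<s : ∀ {y} → y ∈ S → # (λ B → ¬? (y ∈? B)) Bs < s
    missB<s {y} y∈ = subst (_< s) (sym (#-filter (λ B → ¬? (y ∈? B)) avoid? F)) (avoid<s y∈)

    -- Of the s + b members avoiding 1, at most s - 1 miss `y`.
    deg : ∀ {y} → y ∈ S → suc b ≤ # (y ∈?_) Bs
    deg {y} y∈ = +-cancelʳ-≤ _ _ _ (begin
      suc b + # (λ B → ¬? (y ∈? B)) Bs            ≡⟨ +-suc b _ ⟨
      b + suc (# (λ B → ¬? (y ∈? B)) Bs)          ≤⟨ +-monoʳ-≤ b (missB<s y∈) ⟩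
      b + s                                       ≡⟨ +-comm b s ⟩
      s + b                                       ≡⟨ lenB ⟨
      length Bs                                   ≡⟨ #-compl (y ∈?_) Bs ⟨
      # (y ∈?_) Bs + # (λ B → ¬? (y ∈? B)) Bs     ∎)
      where open ≤-Reasoning

    open Incidence k Bs (λ B∈ → uniform (Bs⊆F B∈))

    ∣S∣≤mfun-b : ∣ S ∣ ≤ mfun k s b
    ∣S∣≤mfun-b = mfun-greatest k s b (subst (λ y → ∣ S ∣ * suc b ≤ y * k) lenB (high-degree≤ S b deg))

    -- A sandwich: m ≤ ∣ S ∣ ≤ `mfun k s b` ≤ `mfun k s β` = m, where the last inequality uses β ≤
    -- b.
    mfun-b≡m : mfun k s b ≡ m
    mfun-b≡m = ≤-antisym (mfun-antitone k s 1≤s β≤b) (≤-trans m≤∣S∣ ∣S∣≤mfun-b)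

    ∣S∣≡m : ∣ S ∣ ≡ m
    ∣S∣≡m = ≤-antisym (subst (∣ S ∣ ≤_) mfun-b≡m ∣S∣≤mfun-b) m≤∣S∣

    open Tight s b lenB S deg (subst (λ x → (s + b) * k < suc x * suc b) (trans mfun-b≡m (sym ∣S∣≡m)) (<suc-mfun* k s b))

    inside⇒≡S : k ≡ m → ∀ {B} → B ∈ₗ Bs → B ⊆ S → B ≡ S
    inside⇒≡S k≡m B∈ B⊆S = ⊆∧∣∣≥⇒≡ B⊆S (≤-reflexive (trans ∣S∣≡m (trans (sym k≡m) (sym (uniform (Bs⊆F B∈))))))

    -- For m = k the at least s members inside S all equal S, so s = 1; then every member of Bs contains S.
    m≡k⇒b≡0 : k ≡ m → b ≡ 0
    m≡k⇒b≡0 k≡m = n≤0⇒n≡0 (≤-pred (begin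
      suc b         ≤⟨ +-monoˡ-≤ b 1≤s ⟩
      s + b         ≡⟨ lenB ⟨
      length Bs     ≡⟨ #-all (_≟ₛ S) Bs all≡S ⟨
      # (_≟ₛ S) Bs  ≤⟨ #-≤1 (_≟ₛ S) uBs (λ p q → trans p (sym q)) ⟩
      1             ∎))
      where
      open ≤-Reasoning
      s≤1 : s ≤ 1
      s≤1 = ≤-trans s≤inside (≤-trans
        (#-mono (λ B → ¬? (meet? B (∁ S))) (_≟ₛ S) Bs λ {B} B∈ ¬m → inside⇒≡S k≡m B∈ (¬meet-∁⇒⊆ B S ¬m))
        (#-≤1 (_≟ₛ S) uBs (λ p q → trans p (sym q))))
      S⊆ : ∀ {B} → B ∈ₗ Bs → S ⊆ B
      S⊆ {B} B∈ {y} y∈ = case y ∈? B of λ where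
        (yes y∈B) → y∈B
        (no y∉B) → contradiction (begin
          1                               ≡⟨ ind-yes (¬? (y ∈? B)) y∉B ⟨
          ind (¬? (y ∈? B))               ≤⟨ ∈⇒≤∑ B∈ (λ B → ind (¬? (y ∈? B))) ⟩
          # (λ B → ¬? (y ∈? B)) Bs        ∎) (<⇒≱ (≤-trans (missB<s y∈) s≤1))
      all≡S : ∀ {B} → B ∈ₗ Bs → B ≡ S
      all≡S B∈ = sym (⊆∧∣∣≥⇒≡ (S⊆ B∈) (≤-reflexive (trans (uniform (Bs⊆F B∈)) (trans k≡m (sym ∣S∣≡m)))))

    -- For m > k, β̂ is the largest argument at which `mfun k s` takes the value m, and `b` is one
    -- such argument. For m = k already b = 0.
    b≤β̂ : b ≤ β̂
    b≤β̂ with m≤n⇒m<n∨m≡n (k≤mfun k s β 1≤s)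
    ... | inj₁ k<m = proj₂ (proj₁ isβ̂ k<m) b mfun-b≡m
    ... | inj₂ k≡m = ≤-trans (≤-reflexive (m≡k⇒b≡0 k≡m)) z≤n

    miss? : Decidable {A = Subset (suc n)} (λ A → zero ∈ A × ¬ Nonempty (A ∩ S))
    miss? A = (zero ∈? A) ×-dec ¬? (meet? A S)
    hit? : Decidable {A = Subset (suc n)} (λ A → zero ∈ A × Nonempty (A ∩ S))
    hit? A = (zero ∈? A) ×-dec meet? A S

    -- At least `s` members lie inside `S` and avoid 1. A member through 1 that misses `S` is
    -- disjoint from all of them, so there are fewer than `t` of these.
    #miss≤ : # miss? F ≤ t ∸ 1
    #miss≤ = ≤-pred (≤-trans (#-disjoint<t inside? miss? (≤-trans s≤inside
        (≤-reflexive (#-filter (λ B → ¬? (meet? B (∁ S))) avoid? F)))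
        (λ {A} {B} _ _ (_ , ¬m) (_ , ¬h) m → case meet⁻ A B m of λ where
          (y , y∈A , y∈B) → ¬h (meet⁺ y∈B (¬meet-∁⇒⊆ A S ¬m y∈A))))
      (≤-reflexive (sym (m+[n∸m]≡n 1≤t))))
      where inside? = λ B → avoid? B ×-dec ¬? (meet? B (∁ S))

    #starHit≡D : # (starHit? k S) (cube (suc n)) ≡ D
    #starHit≡D = trans (#-starHit k S 1≤k 0∉S) (cong (λ m → (suc n ∸ 1) C (k ∸ 1) ∸ (suc n ∸ m ∸ 1) C (k ∸ 1)) ∣S∣≡m)

    #hit≤ : # hit? F ≤ D
    #hit≤ = ≤-trans (#≤#cube hit? (starHit? k S) unique (λ A∈ h → uniform A∈ , h)) (≤-reflexive #starHit≡D)

    length≤ : length F ≤ # hit? F + (# miss? F + (s + b))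
    length≤ = begin
      length F                                       ≡⟨ #-compl (zero ∈?_) F ⟨
      # (zero ∈?_) F + # avoid? F                    ≤⟨ +-monoˡ-≤ _ (#-cover (zero ∈?_) hit? miss? F λ {A} _ 0∈ → case meet? A S of λ where
                                                          (yes h) → inj₁ (0∈ , h)
                                                          (no ¬h) → inj₂ (0∈ , ¬h)) ⟩
      # hit? F + # miss? F + # avoid? F              ≡⟨ +-assoc (# hit? F) _ _ ⟩
      # hit? F + (# miss? F + # avoid? F)            ≡⟨ cong (λ x → # hit? F + (# miss? F + x)) (trans (#≡length-filter avoid? F) lenB) ⟩
      # hit? F + (# miss? F + (s + b))               ∎
      where open ≤-Reasoning

  size≤ : length F ≤ bound (suc n) k m s t β̂
  size≤ = ≤-trans length≤ (≤-trans
    (+-mono-≤ #hit≤ (+-mono-≤ #miss≤ (+-monoʳ-≤ s b≤β̂)))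
    (≤-reflexive (sym (bound≡ D s t β̂ 1≤t))))

  -- The families A_i and F_j are the members avoiding 1 and the members through 1 that miss `S`.
  -- Taking their enumerations as parameters, indexed by s + β̂ and t - 1, avoids transports along
  -- equalities of lengths.
  module Equality (hit≡ : # hit? F ≡ D) (b≡β̂ : b ≡ β̂) (a : Fin (s + β̂) → Subset (suc n)) (f : Fin (t ∸ 1) → Subset (suc n))
                  (tab-a : tabulate a ≡ Bs) (tab-f : tabulate f ≡ filter miss? F) where
    Ms = filter miss? F
    c : Fin (s + β̂ + (t ∸ 1)) → Subset (suc n)
    c = append a f
    a∈ : ∀ i → a i ∈ₗ Bs
    a∈ i = subst (a i ∈ₗ_) (tab-a) (Mem.∈-tabulate⁺ i)
    f∈ : ∀ j → f j ∈ₗ Ms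
    f∈ j = subst (f j ∈ₗ_) (tab-f) (Mem.∈-tabulate⁺ j)
    0∉a : ∀ i → zero ∉ a i
    0∉a i = proj₂ (Mem.∈-filter⁻ avoid? {xs = F} (a∈ i))
    f-miss : ∀ j → f j ∈ₗ F × zero ∈ f j × ¬ Nonempty (f j ∩ S)
    f-miss j = Mem.∈-filter⁻ miss? {xs = F} (f∈ j)
    c∈F : ∀ i → c i ∈ₗ F
    c∈F = append-elim a f {_∈ₗ F} (Bs⊆F ∘ a∈) (proj₁ ∘ f-miss)
    c-inj : Injective _≡_ _≡_ c
    c-inj = append-injective a f
      (tabulate-unique⇒injective a (subst Unique (sym (tab-a)) uBs))
      (tabulate-unique⇒injective f (subst Unique (sym (tab-f)) (Unique.filter⁺ miss? unique)))
      (λ i j e → 0∉a i (subst (zero ∈_) (sym e) (proj₁ (proj₂ (f-miss j)))))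
    card : ∀ i → ∣ c i ∣ ≡ k
    card i = uniform (c∈F i)
    As : Fin (s + β̂) → Subset (suc n)
    As = Aset k s t m (s + β̂) c
    G : Fin (t ∸ 1) → Subset (suc n)
    G = Fset k s t m (s + β̂) c
    A≡ : ∀ i → As i ≡ a i
    A≡ = append-↑ˡ a f
    G≡ : ∀ j → G j ≡ f j
    G≡ = append-↑ʳ a f
    tabA : tabulate As ≡ Bs
    tabA = trans (List.tabulate-cong A≡) (tab-a)
    A∌1 : ∀ i → lookupᵥ (As i) one ≡ false
    A∌1 i = ∉⇒lookup≡false (subst (zero ∉_) (sym (A≡ i)) (0∉a i))
    threshold≡ : s + β̂ ∸ s + 1 ≡ suc b
    threshold≡ = trans (s+b∸s+1≡ s β̂) (cong suc (sym b≡β̂))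
    T≡S : T As s ≡ S
    T≡S = ⊆-antisym
      (λ {y} y∈ → high-degree⇒∈ (subst₂ _≤_ threshold≡ (cong (# (y ∈?_)) tabA) (∈T⁻ As s y∈)))
      (λ {y} y∈ → ∈T⁺ As s (subst₂ _≤_ (sym threshold≡) (cong (# (y ∈?_)) (sym tabA)) (deg y∈)))
    ∣T∣≡m : ∣ T As s ∣ ≡ m
    ∣T∣≡m = trans (cong ∣_∣ T≡S) ∣S∣≡m
    count≡ : ∀ X → disjointCount X As ≡ # (λ B → ¬? (meet? X B)) Bs
    count≡ X = trans (disjointCount≡# X As) (cong (# (λ B → ¬? (meet? X B))) tabA)
    miss⇒¬S1A : ∀ {X} → ¬ Nonempty (X ∩ S) → ¬ InS1A k As s X
    miss⇒¬S1A {X} ¬h (_ , d) = contradiction (subst (_< s) (count≡ X) d) (≤⇒≯ (miss⇒s≤disjoint ¬h))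
    F∈S1 : ∀ j → InS1 k (G j) × ¬ InS1A k As s (G j)
    F∈S1 j = (card _ , Vec.[]=⇒lookup (subst (zero ∈_) (sym (G≡ j)) (proj₁ (proj₂ (f-miss j)))))
           , miss⇒¬S1A (subst (λ X → ¬ Nonempty (X ∩ S)) (sym (G≡ j)) (proj₂ (proj₂ (f-miss j))))
    uic : UnionIntersecting s t (tabulate c)
    uic c′ inj c′∈ = ui c′ inj λ i → case Mem.∈-tabulate⁻ (c′∈ i) of λ { (j , e) → subst (_∈ₗ F) (sym e) (c∈F j) }
    -- By `hit≡` the family has as many members through 1 meeting `S` as there are such k-sets, so
    -- it contains them all.
    hit⊇ : ∀ {X} → StarHit k S X → X ∈ₗ F
    hit⊇ {X} h = proj₁ (Mem.∈-filter⁻ hit? {xs = F} (Unique-⊆-length≥⇒⊇ _≟ₛ_ (Unique.filter⁺ hit? unique)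
      (λ {Y} Y∈ → case Mem.∈-filter⁻ hit? {xs = F} Y∈ of λ { (Y∈F , hY) → Mem.∈-filter⁺ (starHit? k S) (∈-cube Y) (uniform Y∈F , hY) })
      (≤-reflexive (trans (sym (#≡length-filter (starHit? k S) (cube (suc n)))) (trans #starHit≡D (trans (sym hit≡) (#≡length-filter hit? F)))))
      (Mem.∈-filter⁺ (starHit? k S) (∈-cube X) h)))
    F⇒ext : ∀ {X} → X ∈ₗ F → InExtremal k s t m (s + β̂) c X
    F⇒ext {X} X∈ with zero ∈? X | meet? X S
    ... | yes 0∈ | yes h = inj₁ ((uniform X∈ , Vec.[]=⇒lookup 0∈) , subst (_< s) (sym (count≡ X)) (hit⇒disjoint<s h))
    ... | yes 0∈ | no ¬h = case Mem.∈-tabulate⁻ (subst (X ∈ₗ_) (sym (tab-f)) (Mem.∈-filter⁺ miss? X∈ (0∈ , ¬h))) of λ where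
      (j , e) → inj₂ (inj₂ (j , trans e (sym (G≡ j))))
    ... | no 0∉  | _     = case Mem.∈-tabulate⁻ (subst (X ∈ₗ_) (sym (tab-a)) (Mem.∈-filter⁺ avoid? X∈ 0∉)) of λ where
      (i , e) → inj₂ (inj₁ (i , trans e (sym (A≡ i))))
    ext⇒F : ∀ {X} → InExtremal k s t m (s + β̂) c X → X ∈ₗ F
    ext⇒F {X} (inj₁ s1a@((cd , 0∈) , _)) with meet? X S
    ... | yes h = hit⊇ (cd , Vec.lookup⇒[]= zero X 0∈ , h)
    ... | no ¬h = contradiction s1a (miss⇒¬S1A ¬h)
    ext⇒F (inj₂ (inj₁ (i , e))) = subst (_∈ₗ F) (sym e) (c∈F _)
    ext⇒F (inj₂ (inj₂ (j , e))) = subst (_∈ₗ F) (sym e) (c∈F _)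
    mem : ∀ X → (X ∈ₗ F → InExtremal k s t m (s + β̂) c (image (Perm.id {suc n}) X)) × (InExtremal k s t m (s + β̂) c (image (Perm.id {suc n}) X) → X ∈ₗ F)
    mem X = (λ X∈ → subst (InExtremal k s t m (s + β̂) c) (sym (image-id X)) (F⇒ext X∈))
          , (λ h → ext⇒F (subst (InExtremal k s t m (s + β̂) c) (image-id X) h))

    extremal : IsExtremal k s t m (s + β̂) F
    -- The centre is already 1, so the identity serves as the isomorphism.
    extremal = c , c-inj , card , A∌1 , ∣T∣≡m , F∈S1 , uic , Perm.id {suc n} , mem

  size≡⇒extremal : length F ≡ bound (suc n) k m s t β̂ → IsExtremal k s t m (s + β̂) F
  size≡⇒extremal eq = Equality.extremal hit≡ (+-cancelˡ-≡ s b β̂ p≡)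
      (proj₁ enumB) (proj₁ enumM) (proj₂ enumB) (proj₂ enumM)
    where
    -- The three classes are bounded separately, and their sum attains the sum of the bounds, so
    -- each bound is attained.
    hit≡×rest≡ : # hit? F ≡ D × # miss? F + (s + b) ≡ (t ∸ 1) + (s + β̂)
    hit≡×rest≡ = squeeze #hit≤ (+-mono-≤ #miss≤ (+-monoʳ-≤ s b≤β̂))
      (≤-trans (≤-reflexive (sym (trans eq (bound≡ D s t β̂ 1≤t)))) length≤)
    hit≡ : # hit? F ≡ D
    hit≡ = proj₁ hit≡×rest≡
    miss≡×p≡ : # miss? F ≡ t ∸ 1 × s + b ≡ s + β̂
    miss≡×p≡ = squeeze #miss≤ (+-monoʳ-≤ s b≤β̂) (≤-reflexive (sym (proj₂ hit≡×rest≡)))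
    p≡ : s + b ≡ s + β̂
    p≡ = proj₂ miss≡×p≡
    enumB : ∃[ a ] tabulate {n = s + β̂} a ≡ Bs
    enumB = enumerate Bs (trans lenB p≡)
    enumM : ∃[ f ] tabulate {n = t ∸ 1} f ≡ filter miss? F
    enumM = enumerate (filter miss? F) (trans (sym (#≡length-filter miss? F)) (proj₁ miss≡×p≡))

-- The graph of heavy pairs

-- The members with `P` form an intersecting subfamily, which is reached by removing the other
-- members.
ℓ≥⇒#¬≥ : {F : List (Subset n)} {q : ℕ} → Unique F → ℓ≥ F q → {P : Pred (Subset n) 0ℓ} (P? : Decidable P) →
         (∀ {A B} → P A → P B → A ∈ₗ F → Nonempty (A ∩ B)) → q ≤ # (λ A → ¬? (P? A)) F
ℓ≥⇒#¬≥ {F = F} {q} u ℓ P? int = +-cancelˡ-≤ (# P? F) _ _ (begin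
  # P? F + q                          ≡⟨ cong (_+ q) (#≡length-filter P? F) ⟩
  length (filter P? F) + q            ≤⟨ ℓ (filter P? F) (Unique.filter⁺ P? u) (All.tabulate (proj₁ ∘ mem))
                                           (λ A∈ B∈ → int (proj₂ (mem A∈)) (proj₂ (mem B∈)) (proj₁ (mem A∈))) ⟩
  length F                            ≡⟨ #-compl P? F ⟨
  # P? F + # (λ A → ¬? (P? A)) F      ∎)
  where
  open ≤-Reasoning
  mem : ∀ {A} → A ∈ₗ filter P? F → A ∈ₗ F × _
  mem = Mem.∈-filter⁻ P? {xs = F}

does≡true⇒ : (d : Dec A) → does d ≡ true → A
does≡true⇒ (yes p) _ = p

-- In units of W = C(n+1, k-3): the degree that makes a pair heavy, and a bound for the number of
-- members that contain no heavy pair.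
heavyFactor lightFactor : ℕ → ℕ → ℕ → ℕ
heavyFactor k s t = suc (t + s * k + (s + 2))
lightFactor k s t = t + s * (k * (t + s * (k * heavyFactor k s t)))

-- Off by one on purpose: `m` is `mfun k s β` minus 1, the largest number of pairs that is still too
-- small. The hypothesis `big` says that ∣F∣ reaches the number of k-sets through a point that meet
-- `m + 1` further points.
module Heavy {n : ℕ} (k r s t β m : ℕ) (k≡ : k ≡ 3 + r) (1≤s : 1 ≤ s) (m≡ : suc m ≡ mfun k s β)
             (F : List (Subset (suc n))) (unique : Unique F) (uniform : ∀ {A} → A ∈ₗ F → ∣ A ∣ ≡ k)
             (ui : UnionIntersecting s t F) (ℓ : ℓ≥ F (s + β))
             (large : threshold r m (lightFactor k s t) ≤ suc n)
             (big : (suc n ∸ 1) C suc (suc r) ∸ (suc n ∸ suc m ∸ 1) C suc (suc r) ≤ length F) where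

  private
    3≤k : 3 ≤ k
    3≤k = subst (3 ≤_) (sym k≡) (m≤m+n 3 r)

  open UniformFamily k s t (≤-trans (s≤s z≤n) 3≤k) F unique uniform ui

  private
    -- `W` bounds the number of members through three points. `D` exceeds t + skW, as needed in
    -- `heavy⇒neither<s`, and s + 2W, as needed in `heavy-meet`.
    W D : ℕ
    W = suc n C r
    D = suc (t + s * (k * W) + (s + (W + W)))

    both? : (x y : Fin (suc n)) → Decidable (λ A → x ∈ A × y ∈ A)
    both? x y A = (x ∈? A) ×-dec (y ∈? A)

    neither? : (x y : Fin (suc n)) → Decidable (λ A → ¬ (x ∈ A) × ¬ (y ∈ A))
    neither? x y A = ¬? (x ∈? A) ×-dec ¬? (y ∈? A)

    Heavy : Fin (suc n) → Fin (suc n) → Set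
    Heavy x y = x ≢ y × D ≤ # (both? x y) F

    heavy? : ∀ x y → Dec (Heavy x y)
    heavy? x y = ¬? (x Fin.≟ y) ×-dec (D ≤? # (both? x y) F)

    avoid≥ : ∀ x → s + β ≤ # (λ A → ¬? (x ∈? A)) F
    avoid≥ x = ℓ≥⇒#¬≥ unique ℓ (x ∈?_) λ p q _ → meet⁺ p q

    pair≤ : ∀ {x y} → x ≢ y → # (both? x y) F ≤ suc n C suc r
    pair≤ {x} {y} x≢y = #-supersets≤ (both? x y) unique k (suc r) (⁅ x ⁆ ∪ ⁅ y ⁆)
      (trans k≡ (cong (_+ suc r) (sym (trans (∣⁅i⁆∪p∣ (x≢y⇒x∉⁅y⁆ x≢y)) (cong suc (∣⁅x⁆∣≡1 y)))))) uniform
      λ {A} (x∈ , y∈) → insert-⊆ {Y = A} x∈ (⁅i⁆⊆ {Y = A} y∈)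

    triple≤ : ∀ {x y z} → x ≢ y → x ≢ z → y ≢ z → # (λ A → both? x y A ×-dec (z ∈? A)) F ≤ W
    triple≤ {x} {y} {z} x≢y x≢z y≢z = #-supersets≤ (λ A → both? x y A ×-dec (z ∈? A)) unique k r (⁅ x ⁆ ∪ (⁅ y ⁆ ∪ ⁅ z ⁆))
      (trans k≡ (cong (_+ r) (sym (trans (∣⁅i⁆∪p∣ x∉) (cong suc (trans (∣⁅i⁆∪p∣ (x≢y⇒x∉⁅y⁆ y≢z)) (cong suc (∣⁅x⁆∣≡1 z)))))))) uniform
      λ {A} ((x∈ , y∈) , z∈) → insert-⊆ {Y = A} x∈ (insert-⊆ {Y = A} y∈ (⁅i⁆⊆ {Y = A} z∈))
      where
      x∉ : x ∉ ⁅ y ⁆ ∪ ⁅ z ⁆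
      x∉ h = case x∈p∪q⁻ ⁅ y ⁆ ⁅ z ⁆ h of λ where
        (inj₁ p) → x≢y (x∈⁅y⁆⇒x≡y y p)
        (inj₂ p) → x≢z (x∈⁅y⁆⇒x≡y z p)

    -- Suppose `s` members avoid `x` and `y`. All but fewer than `t` members through `x` and `y`
    -- contain one of the at most sk points of their union, each a third point, which leaves at most
    -- t + skW < D of them.
    heavy⇒neither<s : ∀ {x y} → Heavy x y → # (neither? x y) F < s
    heavy⇒neither<s {x} {y} (x≢y , D≤) = ≰⇒> λ s≤ → <⇒≱ (s≤s (m≤m+n (t + s * (k * W)) (s + (W + W)))) (≤-trans D≤
      (#-≤-localDegrees (both? x y) (neither? x y) {W} s≤ λ {B} {v} _ (x∉ , y∉) v∈ →
        triple≤ x≢y (λ e → x∉ (subst (_∈ B) (sym e) v∈)) (λ e → y∉ (subst (_∈ B) (sym e) v∈))))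

    -- If the pairs were disjoint, a member through `x` and `y` would avoid both `u` and `v`, which
    -- fewer than `s` members do, or contain three of the four points. That allows at most s + 2W <
    -- D members.
    heavy-meet : ∀ {x y u v} → Heavy x y → Heavy u v → (u ≡ x ⊎ v ≡ x) ⊎ (u ≡ y ⊎ v ≡ y)
    heavy-meet {x} {y} {u} {v} (x≢y , D≤) uv@(u≢v , _)
      with u Fin.≟ x | v Fin.≟ x | u Fin.≟ y | v Fin.≟ y
    ... | yes e | _ | _ | _ = inj₁ (inj₁ e)
    ... | no _ | yes e | _ | _ = inj₁ (inj₂ e)
    ... | no _ | no _ | yes e | _ = inj₂ (inj₁ e)
    ... | no _ | no _ | no _ | yes e = inj₂ (inj₂ e)
    ... | no u≢x | no v≢x | no u≢y | no v≢y = contradiction D≤ (<⇒≱ (begin-strict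
        # (both? x y) F                                    ≤⟨ #-cover (both? x y) (neither? u v) with-uv? F (λ {A} _ xy → split {A} xy) ⟩
        # (neither? u v) F + # with-uv? F                  ≤⟨ +-monoʳ-≤ _ (#-cover with-uv? (with? u) (with? v) F (λ { _ (xy , inj₁ p) → inj₁ (xy , p) ; _ (xy , inj₂ p) → inj₂ (xy , p) })) ⟩
        # (neither? u v) F + (# (with? u) F + # (with? v) F) ≤⟨ +-mono-≤ (<⇒≤ (heavy⇒neither<s uv))
                                                                (+-mono-≤ (triple≤ x≢y (u≢x ∘ sym) (u≢y ∘ sym)) (triple≤ x≢y (v≢x ∘ sym) (v≢y ∘ sym))) ⟩
        s + (W + W)                                        ≤⟨ m≤n+m _ (t + s * (k * W)) ⟩
        t + s * (k * W) + (s + (W + W))                    <⟨ ≤-refl ⟩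
        D                                                  ∎))
      where
      open ≤-Reasoning
      with? = λ z A → both? x y A ×-dec (z ∈? A)
      with-uv? = λ A → both? x y A ×-dec ((u ∈? A) ⊎-dec (v ∈? A))
      split : ∀ {A} → x ∈ A × y ∈ A → (u ∉ A × v ∉ A) ⊎ ((x ∈ A × y ∈ A) × (u ∈ A ⊎ v ∈ A))
      split {A} xy with u ∈? A | v ∈? A
      ... | yes p | _     = inj₂ (xy , inj₁ p)
      ... | no _  | yes p = inj₂ (xy , inj₂ p)
      ... | no p  | no q  = inj₁ (p , q)

    Light : Pred (Subset (suc n)) 0ℓ
    Light A = ¬ (∃[ x ] ∃[ y ] Heavy x y × x ∈ A × y ∈ A)

    heavyIn? : ∀ A → Dec (∃[ x ] ∃[ y ] Heavy x y × x ∈ A × y ∈ A)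
    heavyIn? A = Fin.any? λ x → Fin.any? λ y → heavy? x y ×-dec both? x y A

    light? : Decidable Light
    light? A = ¬? (heavyIn? A)

    -- Two applications of the local degree bound: first to pass to light members through a point
    -- `v`, then, with `s` members avoiding `v`, to those through `v` and a second point. If a light
    -- member contains such a pair, the pair is not heavy and has degree below `D`.
    #light≤ : # light? F ≤ t + s * (k * (t + s * (k * D)))
    #light≤ = #-≤-localDegrees light? any? {t + s * (k * D)}
      (≤-trans (m≤m+n s β) (≤-trans (avoid≥ zero) (#-mono (λ A → ¬? (zero ∈? A)) any? F λ _ → inj₂)))
      λ {_} {v} _ _ _ → #-≤-localDegrees (λ A → light? A ×-dec (v ∈? A)) (λ A → ¬? (v ∈? A)) {D}
        (≤-trans (m≤m+n s β) (avoid≥ v))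
        λ {B} {w} _ v∉ w∈ → pairwise v w λ e → v∉ (subst (_∈ B) (sym e) w∈)
      where
      -- A predicate that always holds: the first application may use any `s` members.
      any? = λ A → zero ∈? A ⊎-dec ¬? (zero ∈? A)
      pairwise : ∀ v w → v ≢ w → # (λ A → (light? A ×-dec (v ∈? A)) ×-dec (w ∈? A)) F ≤ D
      pairwise v w v≢w with D ≤? # (both? v w) F
      ... | yes D≤ = ≤-trans (≤-reflexive (#-none (λ A → (light? A ×-dec (v ∈? A)) ×-dec (w ∈? A)) F λ _ ((l , v∈) , w∈) → l (v , w , (v≢w , D≤) , v∈ , w∈))) z≤n
      ... | no D≰  = ≤-trans (#-mono (λ A → (light? A ×-dec (v ∈? A)) ×-dec (w ∈? A)) (both? v w) F λ _ ((_ , v∈) , w∈) → v∈ , w∈) (<⇒≤ (≰⇒> D≰))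

    1≤W : 1 ≤ W
    1≤W = C-pos (≤-trans (≤-trans (m≤m+n r _) (m≤n+m _ (suc (suc m)))) large)

    -- As W ≥ 1, every summand without `W` may be multiplied by it.
    light≤ : t + s * (k * (t + s * (k * D))) ≤ lightFactor k s t * W
    light≤ = begin
      t + s * (k * (t + s * (k * D)))
        ≤⟨ +-mono-≤ t≤ (*-monoʳ-≤ s (*-monoʳ-≤ k (+-mono-≤ t≤ (*-monoʳ-≤ s (*-monoʳ-≤ k D≤))))) ⟩
      t * W + s * (k * (t * W + s * (k * (h * W))))
        ≡⟨ e t W s k h ⟩
      (t + s * (k * (t + s * (k * h)))) * W ∎
      where
      open ≤-Reasoning
      h = heavyFactor k s t
      e : ∀ t W s k h → t * W + s * (k * (t * W + s * (k * (h * W)))) ≡ (t + s * (k * (t + s * (k * h)))) * W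
      e = solve-∀
      e′ : ∀ t W s k → W + (t * W + s * (k * W) + (s * W + (W + W))) ≡ suc (t + s * k + (s + 2)) * W
      e′ = solve-∀
      x≤xW : ∀ x → x ≤ x * W
      x≤xW x = ≤-trans (≤-reflexive (sym (*-identityʳ x))) (*-monoʳ-≤ x 1≤W)
      t≤ : t ≤ t * W
      t≤ = x≤xW t
      D≤ : D ≤ h * W
      D≤ = begin
        suc (t + s * (k * W) + (s + (W + W)))                ≤⟨ +-mono-≤ 1≤W (+-mono-≤ (+-monoˡ-≤ (s * (k * W)) t≤) (+-monoˡ-≤ (W + W) (x≤xW s))) ⟩
        W + (t * W + s * (k * W) + (s * W + (W + W)))        ≡⟨ e′ t W s k ⟩
        h * W                                                ∎

    -- Every member with a heavy pair contains a pair from `ps`, and a pair has degree at most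
    -- `suc n C suc r`. With `m` pairs or fewer, these members and the light ones together would be
    -- too few by `few-pairs-bound`.
    many-pairs : (ps : List (Fin (suc n) × Fin (suc n))) → (∀ {p} → p ∈ₗ ps → proj₁ p ≢ proj₂ p) →
                 (∀ {A x y} → Heavy x y → x ∈ A → y ∈ A → ∃[ p ] p ∈ₗ ps × proj₁ p ∈ A × proj₂ p ∈ A) → m < length ps
    many-pairs ps distinct cover = ≰⇒> λ len≤ → <⇒≱ (few-pairs-bound r m (lightFactor k s t) n large) (≤-trans big (begin
      length F                                           ≡⟨ #-compl heavyIn? F ⟨
      # heavyIn? F + # light? F                          ≤⟨ +-mono-≤ (#-⋃ heavyIn? ps (λ p → both? (proj₁ p) (proj₂ p)) F
                                                              λ { _ (x , y , h , x∈ , y∈) → cover h x∈ y∈ })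
                                                              (≤-trans #light≤ light≤) ⟩
      ∑ ps (λ p → # (both? (proj₁ p) (proj₂ p)) F) + lightFactor k s t * W
                                                         ≤⟨ +-monoˡ-≤ _ (∑-≤ ps λ p∈ → pair≤ (distinct p∈)) ⟩
      length ps * (suc n C suc r) + lightFactor k s t * W ≤⟨ +-monoˡ-≤ _ (*-monoˡ-≤ (suc n C suc r) len≤) ⟩
      m * (suc n C suc r) + lightFactor k s t * W        ∎))
      where open ≤-Reasoning

    Triangle : Fin (suc n) → Fin (suc n) → Fin (suc n) → Set
    Triangle a b c = Heavy a b × Heavy b c × Heavy a c

    Centre : Fin (suc n) → Set
    Centre x = ∀ {u v} → Heavy u v → u ≡ x ⊎ v ≡ x

    heavy-sym : ∀ {x y} → Heavy x y → Heavy y x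
    heavy-sym {x} {y} (x≢y , D≤) = x≢y ∘ sym , ≤-trans D≤ (#-mono (both? x y) (both? y x) F λ _ (p , q) → q , p)

    centre⊎ : ∀ x → Centre x ⊎ (∃[ u ] ∃[ v ] Heavy u v × u ≢ x × v ≢ x)
    centre⊎ x with Fin.any? (λ u → Fin.any? λ v → heavy? u v ×-dec ¬? (u Fin.≟ x) ×-dec ¬? (v Fin.≟ x))
    ... | yes w = inj₂ w
    ... | no ¬w = inj₁ λ {u} {v} h → case u Fin.≟ x of λ where
      (yes e) → inj₁ e
      (no u≢) → case v Fin.≟ x of λ where
        (yes e) → inj₂ e
        (no v≢) → contradiction (u , v , h , u≢ , v≢) ¬w

    -- The pair `u`, `v` meets `x`, `y` but not in `x`, so it contains `y`; the witness `w` is its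
    -- other end.
    through : ∀ {x y u v} → Heavy x y → Heavy u v → u ≢ x → v ≢ x → ∃[ w ] Heavy y w × w ≢ x × (w ≡ u ⊎ w ≡ v)
    through xy uv u≢x v≢x with heavy-meet xy uv
    ... | inj₁ (inj₁ e)    = contradiction e u≢x
    ... | inj₁ (inj₂ e)    = contradiction e v≢x
    ... | inj₂ (inj₁ refl) = _ , uv , v≢x , inj₂ refl
    ... | inj₂ (inj₂ refl) = _ , heavy-sym uv , u≢x , inj₁ refl

    -- If neither end of a heavy pair `a`, `b` is a centre, there are heavy pairs `b`, `c` and `a`,
    -- `d` with c ≠ a and d ≠ b. These must meet, so c = d.
    centre⊎triangle : (∃[ x ] Centre x) ⊎ (∃[ a ] ∃[ b ] ∃[ c ] Triangle a b c)
    centre⊎triangle with Fin.any? (λ a → Fin.any? λ b → heavy? a b)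
    -- Without heavy pairs every point is a centre vacuously.
    ... | no ¬h = inj₁ (zero , λ {u} {v} h → contradiction (u , v , h) ¬h)
    ... | yes (a , b , ab) with centre⊎ a
    ...   | inj₁ c = inj₁ (a , c)
    ...   | inj₂ (u , v , uv , u≢a , v≢a) with through ab uv u≢a v≢a | centre⊎ b
    ...     | _ | inj₁ c = inj₁ (b , c)
    ...     | c , bc , c≢a , _ | inj₂ (u′ , v′ , uv′ , u≢b , v≢b)
              with through (heavy-sym ab) uv′ u≢b v≢b
    ...       | d , ad , _ , d∈ = inj₂ (a , b , c , ab , bc , ac)
      where
      ac : Heavy a c
      ac with heavy-meet bc ad
      ... | inj₁ (inj₁ refl) = contradiction refl (proj₁ ab)
      ... | inj₁ (inj₂ refl) = case d∈ of λ where
        (inj₁ refl) → contradiction refl u≢b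
        (inj₂ refl) → contradiction refl v≢b
      ... | inj₂ (inj₁ refl) = contradiction refl c≢a
      ... | inj₂ (inj₂ refl) = ad

    -- The members with at least two of the points a, b, c form an intersecting family, and each of the others
    -- misses a heavy pair. Hence s + β ≤ 3 (s - 1), so m ≥ 4 and the three pairs are too few.
    ¬triangle : ∀ {a b c} → ¬ Triangle a b c
    ¬triangle {a} {b} {c} (ab , bc , ac) = contradiction (many-pairs ps distinct cover) (≤⇒≯ (≤-pred (subst (4 ≤_) (sym m≡) 4≤mfun)))
      where
      ps = (a , b) ∷ (b , c) ∷ (a , c) ∷ []
      distinct : ∀ {p} → p ∈ₗ ps → proj₁ p ≢ proj₂ p
      distinct (here refl) = proj₁ ab
      distinct (there (here refl)) = proj₁ bc
      distinct (there (there (here refl))) = proj₁ ac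
      cover : ∀ {A x y} → Heavy x y → x ∈ A → y ∈ A → ∃[ p ] p ∈ₗ ps × proj₁ p ∈ A × proj₂ p ∈ A
      cover {A} {x} {y} xy x∈ y∈ = combine (hit ab) (hit bc) (hit ac)
        where
        -- The heavy pair inside `A` meets every side of the triangle, so `A` contains an end of
        -- each side and hence two of the corners.
        hit : ∀ {u v} → Heavy u v → u ∈ A ⊎ v ∈ A
        hit uv = case heavy-meet uv xy of λ where
          (inj₁ (inj₁ refl)) → inj₁ x∈
          (inj₁ (inj₂ refl)) → inj₁ y∈
          (inj₂ (inj₁ refl)) → inj₂ x∈
          (inj₂ (inj₂ refl)) → inj₂ y∈
        combine : a ∈ A ⊎ b ∈ A → b ∈ A ⊎ c ∈ A → a ∈ A ⊎ c ∈ A → ∃[ p ] p ∈ₗ ps × proj₁ p ∈ A × proj₂ p ∈ A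
        combine (inj₁ p) (inj₁ q) _        = _ , here refl , p , q
        combine (inj₁ p) (inj₂ q) _        = _ , there (there (here refl)) , p , q
        combine (inj₂ p) _        (inj₁ q) = _ , here refl , q , p
        combine (inj₂ p) _        (inj₂ q) = _ , there (here refl) , p , q
      Two : Pred (Subset (suc n)) 0ℓ
      Two A = (a ∈ A × b ∈ A) ⊎ (b ∈ A × c ∈ A) ⊎ (a ∈ A × c ∈ A)
      two? : Decidable Two
      two? A = both? a b A ⊎-dec both? b c A ⊎-dec both? a c A
      two-meet : ∀ {A B} → Two A → Two B → Nonempty (A ∩ B)
      two-meet (inj₁ (p , q))        (inj₁ (p′ , q′))        = meet⁺ p p′
      two-meet (inj₁ (p , q))        (inj₂ (inj₁ (p′ , q′))) = meet⁺ q p′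
      two-meet (inj₁ (p , q))        (inj₂ (inj₂ (p′ , q′))) = meet⁺ p p′
      two-meet (inj₂ (inj₁ (p , q))) (inj₁ (p′ , q′))        = meet⁺ p q′
      two-meet (inj₂ (inj₁ (p , q))) (inj₂ (inj₁ (p′ , q′))) = meet⁺ p p′
      two-meet (inj₂ (inj₁ (p , q))) (inj₂ (inj₂ (p′ , q′))) = meet⁺ q q′
      two-meet (inj₂ (inj₂ (p , q))) (inj₁ (p′ , q′))        = meet⁺ p p′
      two-meet (inj₂ (inj₂ (p , q))) (inj₂ (inj₁ (p′ , q′))) = meet⁺ q q′
      two-meet (inj₂ (inj₂ (p , q))) (inj₂ (inj₂ (p′ , q′))) = meet⁺ p p′
      rest? = λ A → neither? b c A ⊎-dec neither? a c A
      missing : ∀ {A} → ¬ Two A → (a ∉ A × b ∉ A) ⊎ ((b ∉ A × c ∉ A) ⊎ (a ∉ A × c ∉ A))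
      missing {A} ¬two with a ∈? A | b ∈? A | c ∈? A
      ... | yes p | yes q | _     = contradiction (inj₁ (p , q)) ¬two
      ... | yes p | no q  | yes r = contradiction (inj₂ (inj₂ (p , r))) ¬two
      ... | yes p | no q  | no r  = inj₂ (inj₁ (q , r))
      ... | no p  | yes q | yes r = contradiction (inj₂ (inj₁ (q , r))) ¬two
      ... | no p  | yes q | no r  = inj₂ (inj₂ (p , r))
      ... | no p  | no q  | _     = inj₁ (p , q)
      open ≤-Reasoning
      s+β+3≤3s : s + β + 3 ≤ s + (s + s)
      s+β+3≤3s = begin
        s + β + 3                       ≤⟨ +-monoˡ-≤ 3 (ℓ≥⇒#¬≥ unique ℓ two? λ {A} {B} p q _ → two-meet {A} {B} p q) ⟩
        # (λ A → ¬? (two? A)) F + 3     ≤⟨ +-monoˡ-≤ 3 (≤-trans (#-cover (λ A → ¬? (two? A)) (neither? a b) rest? F λ _ → missing)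
                                             (+-monoʳ-≤ (# (neither? a b) F) (#-cover rest? (neither? b c) (neither? a c) F λ _ → id))) ⟩
        # (neither? a b) F + (# (neither? b c) F + # (neither? a c) F) + 3
                                        ≡⟨ e (# (neither? a b) F) (# (neither? b c) F) (# (neither? a c) F) ⟩
        suc (# (neither? a b) F) + (suc (# (neither? b c) F) + suc (# (neither? a c) F))
                                        ≤⟨ +-mono-≤ (heavy⇒neither<s ab) (+-mono-≤ (heavy⇒neither<s bc) (heavy⇒neither<s ac)) ⟩
        s + (s + s)                     ∎
        where
        e : ∀ x y z → x + (y + z) + 3 ≡ suc x + (suc y + suc z)
        e = solve-∀
      -- From s + β + 3 ≤ 3s and s ≥ 1 follows β + 4 ≤ 3s, that is, 4(β + 1) ≤ 3(s + β) ≤ (s + β)k.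
      4≤mfun : 4 ≤ mfun k s β
      4≤mfun = mfun-greatest k s β (begin
        4 * suc β                       ≡⟨ e₁ β ⟩
        β + 3 + 3 * β + 1               ≤⟨ +-monoʳ-≤ (β + 3 + 3 * β) 1≤s ⟩
        β + 3 + 3 * β + s               ≡⟨ e₂ β s ⟩
        (s + β + 3) + 3 * β             ≤⟨ +-monoˡ-≤ (3 * β) s+β+3≤3s ⟩
        s + (s + s) + 3 * β             ≡⟨ e₃ s β ⟩
        (s + β) * 3                     ≤⟨ *-monoʳ-≤ (s + β) 3≤k ⟩
        (s + β) * k                     ∎)
        where
        e₁ : ∀ β → 4 * suc β ≡ β + 3 + 3 * β + 1
        e₁ = solve-∀
        e₂ : ∀ β s → β + 3 + 3 * β + s ≡ (s + β + 3) + 3 * β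
        e₂ = solve-∀
        e₃ : ∀ s β → s + (s + s) + 3 * β ≡ (s + β) * 3
        e₃ = solve-∀

  -- `S` consists of the heavy neighbours of the centre. Every heavy pair joins `x` to a point of
  -- `S`, so `many-pairs` applied to these pairs gives more than `m` leaves.
  centre : ∃[ x ] Σ (Subset (suc n)) λ S → x ∉ S × suc m ≤ ∣ S ∣ ×
           (∀ {y} → y ∈ S → # (λ A → ¬? (x ∈? A) ×-dec ¬? (y ∈? A)) F < s)
  centre with centre⊎triangle
  ... | inj₂ (a , b , c , tri) = contradiction tri ¬triangle
  ... | inj₁ (x , cen) = x , S , (λ x∈ → proj₁ (∈S⁻ x∈) refl) , m<∣S∣ , (λ y∈ → heavy⇒neither<s (∈S⁻ y∈))
    where
    S : Subset (suc n)
    S = tabulateᵥ (λ y → does (heavy? x y))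
    ∈S⁻ : ∀ {y} → y ∈ S → Heavy x y
    ∈S⁻ {y} y∈ = does≡true⇒ (heavy? x y) (trans (sym (Vec.lookup∘tabulate (λ y → does (heavy? x y)) y)) (Vec.[]=⇒lookup y∈))
    ∈S⁺ : ∀ {y} → Heavy x y → y ∈ S
    ∈S⁺ {y} h = Vec.lookup⇒[]= y S (trans (Vec.lookup∘tabulate (λ y → does (heavy? x y)) y) (dec-true (heavy? x y) h))
    ys = filter (_∈? S) (allFin (suc n))
    ps = map (x ,_) ys
    m<∣S∣ : suc m ≤ ∣ S ∣
    m<∣S∣ = subst (m <_) (trans (List.length-map (x ,_) ys) (trans (sym (#≡length-filter (_∈? S) (allFin (suc n)))) (sym (∣p∣≡# S))))
      (many-pairs ps
        (λ p∈ → case Mem.∈-map⁻ (x ,_) p∈ of λ { (y , y∈ , refl) → proj₁ (∈S⁻ (proj₂ (Mem.∈-filter⁻ (_∈? S) {xs = allFin (suc n)} y∈))) })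
        (λ {A} {u} {v} uv u∈ v∈ → case cen uv of λ where
          (inj₁ refl) → _ , Mem.∈-map⁺ (x ,_) (Mem.∈-filter⁺ (_∈? S) (Mem.∈-allFin v) (∈S⁺ uv)) , u∈ , v∈
          (inj₂ refl) → _ , Mem.∈-map⁺ (x ,_) (Mem.∈-filter⁺ (_∈? S) (Mem.∈-allFin u) (∈S⁺ (heavy-sym uv))) , v∈ , u∈))

-- Moving the centre to `one`

∣image∣≥ : (σ : Permutation′ n) (A : Subset n) → ∣ A ∣ ≤ ∣ image σ A ∣
∣image∣≥ {n} σ A = begin
  ∣ A ∣                                        ≡⟨ card A ⟨
  length (elements A)                          ≡⟨ List.length-map (σ ⟨$⟩ʳ_) (elements A) ⟨
  length (map (σ ⟨$⟩ʳ_) (elements A))           ≤⟨ Unique-⊆⇒length≤ Fin._≟_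
                                                    (Unique.map⁺ injective (Unique.filter⁺ (_∈? A) (Unique.allFin⁺ n))) moved ⟩
  length (elements (image σ A))                ≡⟨ card (image σ A) ⟩
  ∣ image σ A ∣                                ∎
  where
  open ≤-Reasoning
  elements : Subset n → List (Fin n)
  elements X = filter (_∈? X) (allFin n)
  card : ∀ X → length (elements X) ≡ ∣ X ∣
  card X = trans (sym (#≡length-filter (_∈? X) (allFin n))) (sym (∣p∣≡# X))
  injective : ∀ {x y} → σ ⟨$⟩ʳ x ≡ σ ⟨$⟩ʳ y → x ≡ y
  injective e = trans (sym (inverseˡ σ)) (trans (cong (σ ⟨$⟩ˡ_) e) (inverseˡ σ))
  moved : ∀ {y} → y ∈ₗ map (σ ⟨$⟩ʳ_) (elements A) → y ∈ₗ elements (image σ A)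
  moved y∈ with Mem.∈-map⁻ (σ ⟨$⟩ʳ_) y∈
  ... | x , x∈ , refl = Mem.∈-filter⁺ (_∈? image σ A) (Mem.∈-allFin _)
    (∈image⁺ σ A (subst (_∈ A) (sym (inverseˡ σ)) (proj₂ (Mem.∈-filter⁻ (_∈? A) {xs = allFin n} x∈))))

∣image∣ : (σ : Permutation′ n) (A : Subset n) → ∣ image σ A ∣ ≡ ∣ A ∣
∣image∣ σ A = ≤-antisym
  (≤-trans (∣image∣≥ (flip σ) (image σ A)) (≤-reflexive (cong ∣_∣ (image-flip σ A))))
  (∣image∣≥ σ A)

image-unionIntersecting : ∀ (σ : Permutation′ n) s t {F : List (Subset n)} →
                          UnionIntersecting s t F → UnionIntersecting s t (map (image σ) F)
image-unionIntersecting σ s t {F} ui c inj c∈ =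
  case crossing⁻ s t c′ (ui c′ (inj ∘ image-injective (flip σ)) c′∈) of λ where
    (i , j , v , v∈i , v∈j) →
      crossing⁺ s t c (i , j , σ ⟨$⟩ʳ v , ∈image⁻ (flip σ) (c (i ↑ˡ t)) v∈i , ∈image⁻ (flip σ) (c (s ↑ʳ j)) v∈j)
  where
  c′ = image (flip σ) ∘ c
  c′∈ : ∀ i → c′ i ∈ₗ F
  c′∈ i with Mem.∈-map⁻ (image σ) (c∈ i)
  ... | A , A∈ , e = subst (_∈ₗ F) (sym (trans (cong (image (flip σ)) e) (image-flip σ A))) A∈

-- Extremality is a statement up to isomorphism: the sets in `c` stay, and only the permutation is
-- composed with `σ`.
image-extremal : ∀ (σ : Permutation′ (suc n)) {k s t m p} {F : List (Subset (suc n))} →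
                 IsExtremal k s t m p (map (image σ) F) → IsExtremal k s t m p F
image-extremal {n} σ {k} {s} {t} {m} {p} {F} (c , inj , card , A∌1 , ∣T∣≡m , F∈S1 , ui , π , mem) =
  c , inj , card , A∌1 , ∣T∣≡m , F∈S1 , ui , σ ∘ₚ π , mem′
  where
  image-∘ : ∀ A → image (σ ∘ₚ π) A ≡ image π (image σ A)
  image-∘ A = sym (Vec.tabulate-cong λ y → Vec.lookup∘tabulate (λ z → lookupᵥ A (σ ⟨$⟩ˡ z)) (π ⟨$⟩ˡ y))
  mem′ : ∀ A → (A ∈ₗ F → InExtremal k s t m p c (image (σ ∘ₚ π) A)) × (InExtremal k s t m p c (image (σ ∘ₚ π) A) → A ∈ₗ F)
  mem′ A = (λ A∈ → subst (InExtremal k s t m p c) (sym (image-∘ A)) (proj₁ (mem (image σ A)) (Mem.∈-map⁺ (image σ) A∈)))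
         , (λ h → case Mem.∈-map⁻ (image σ) (proj₂ (mem (image σ A)) (subst (InExtremal k s t m p c) (image-∘ A) h)) of λ where
             (B , B∈ , e) → subst (_∈ₗ F) (sym (image-injective σ e)) B∈)

-- The transposition of `x` and `zero` carries the hypotheses to those of `Star`, and both
-- conclusions are carried back.
module Centred {n : ℕ} (k s t β β̂ : ℕ) (1≤k : 1 ≤ k) (1≤s : 1 ≤ s) (1≤t : 1 ≤ t) (isβ̂ : IsBetaHat k s β β̂)
               (F : List (Subset (suc n))) (unique : Unique F) (uniform : ∀ {A} → A ∈ₗ F → ∣ A ∣ ≡ k)
               (ui : UnionIntersecting s t F) (x : Fin (suc n))
               (avoid≥ : s + β ≤ # (λ A → ¬? (x ∈? A)) F)
               (S : Subset (suc n)) (x∉S : x ∉ S) (m≤∣S∣ : mfun k s β ≤ ∣ S ∣)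
               (avoid<s : ∀ {y} → y ∈ S → # (λ A → ¬? (x ∈? A) ×-dec ¬? (y ∈? A)) F < s) where

  private
    σ : Permutation′ (suc n)
    σ = transpose x zero
    F′ = map (image σ) F

    uniform′ : ∀ {A} → A ∈ₗ F′ → ∣ A ∣ ≡ k
    uniform′ A∈ with Mem.∈-map⁻ (image σ) A∈
    ... | B , B∈ , refl = trans (∣image∣ σ B) (uniform B∈)

    avoid≥′ : s + β ≤ # (λ A → ¬? (zero ∈? A)) F′
    avoid≥′ = ≤-trans avoid≥ (≤-trans
      (#-mono (λ A → ¬? (x ∈? A)) (λ A → ¬? (zero ∈? image σ A)) F λ {A} _ x∉ 0∈ → x∉ (∈image⁻ σ A 0∈))
      (≤-reflexive (sym (∑-map (image σ) F _))))

    avoid<s′ : ∀ {y} → y ∈ image σ S → # (λ A → ¬? (zero ∈? A) ×-dec ¬? (y ∈? A)) F′ < s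
    avoid<s′ {y} y∈ = ≤-trans (s≤s (≤-trans (≤-reflexive (∑-map (image σ) F _))
      (#-mono (λ A → ¬? (zero ∈? image σ A) ×-dec ¬? (y ∈? image σ A)) (λ A → ¬? (x ∈? A) ×-dec ¬? (σ ⟨$⟩ˡ y ∈? A)) F
        λ {A} _ (0∉ , y∉) → (λ x∈ → 0∉ (∈image⁺ σ A x∈)) , (λ y∈A → y∉ (∈image⁺ σ A y∈A)))))
      (avoid<s (∈image⁻ σ S y∈))

    module AtOne = Star k s t β β̂ 1≤k 1≤s 1≤t isβ̂ F′ (Unique.map⁺ (image-injective σ) unique) uniform′
      (image-unionIntersecting σ s t ui) avoid≥′ (image σ S) (λ 0∈ → x∉S (∈image⁻ σ S 0∈))
      (≤-trans m≤∣S∣ (≤-reflexive (sym (∣image∣ σ S)))) avoid<s′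

  size≤ : length F ≤ bound (suc n) k (mfun k s β) s t β̂
  size≤ = subst (_≤ bound (suc n) k (mfun k s β) s t β̂) (List.length-map (image σ) F) AtOne.size≤

  size≡⇒extremal : length F ≡ bound (suc n) k (mfun k s β) s t β̂ → IsExtremal k s t (mfun k s β) (s + β̂) F
  size≡⇒extremal eq = image-extremal σ (AtOne.size≡⇒extremal (trans (List.length-map (image σ) F) eq))

-- Reduction to families that reach the bound, and the theorem

mfun-β̂ : ∀ {k s β β̂} → 1 ≤ s → IsBetaHat k s β β̂ → mfun k s β̂ ≡ mfun k s β
mfun-β̂ {k} {s} {β} 1≤s (larger , same) with m≤n⇒m<n∨m≡n (k≤mfun k s β 1≤s)
... | inj₁ k<m = proj₁ (larger k<m)
... | inj₂ k≡m = cong (mfun k s) (same (sym k≡m))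

-- A family that reaches the bound has at least as many members as the main term of the bound, which
-- is the size that `Heavy` requires.
largeFamily : ∀ (k s t β : ℕ) (3≤k : 3 ≤ k) → 1 ≤ s → s ≤ t →
  ∀ n → threshold (k ∸ 3) (mfun k s β ∸ 1) (lightFactor k s t) ≤ suc n → ∀ β̂ → IsBetaHat k s β β̂ →
  (F : List (Subset (suc n))) → Unique F → Uniform k F → UnionIntersecting s t F → ℓ≥ F (s + β) →
  bound (suc n) k (mfun k s β) s t β̂ ≤ length F →
  length F ≤ bound (suc n) k (mfun k s β) s t β̂
  × (length F ≡ bound (suc n) k (mfun k s β) s t β̂ → IsExtremal k s t (mfun k s β) (s + β̂) F)
largeFamily k s t β 3≤k 1≤s s≤t n large β̂ isβ̂ F unique uni ui ℓ bound≤ =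
  case Heavy.centre k (k ∸ 3) s t β (m ∸ 1) k≡ 1≤s m≡ F unique (All.lookup uni) ui ℓ large star≤ of λ where
    (x , S , x∉S , m≤ , avoid<s) →
      let module C = Centred k s t β β̂ 1≤k 1≤s 1≤t isβ̂ F unique (All.lookup uni) ui x
            (ℓ≥⇒#¬≥ unique ℓ (x ∈?_) λ p q _ → meet⁺ p q) S x∉S (subst (_≤ ∣ S ∣) m≡ m≤) avoid<s
      in C.size≤ , C.size≡⇒extremal
  where
  m = mfun k s β
  k≡ : k ≡ 3 + (k ∸ 3)
  k≡ = sym (m+[n∸m]≡n 3≤k)
  1≤k = ≤-trans (s≤s z≤n) 3≤k
  1≤t = ≤-trans 1≤s s≤t
  m≡ : suc (m ∸ 1) ≡ m
  m≡ = m+[n∸m]≡n (≤-trans 1≤k (k≤mfun k s β 1≤s))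
  star : ℕ → ℕ → ℕ
  star m j = (suc n ∸ 1) C j ∸ (suc n ∸ m ∸ 1) C j
  star≤ : star (suc (m ∸ 1)) (suc (suc (k ∸ 3))) ≤ length F
  star≤ = subst₂ (λ m j → star m j ≤ length F) (sym m≡) (cong (_∸ 1) k≡) (begin
    star m (k ∸ 1)                            ≤⟨ m≤m+n _ _ ⟩
    star m (k ∸ 1) + ((t ∸ 1) + (s + β̂))      ≡⟨ bound≡ (star m (k ∸ 1)) s t β̂ 1≤t ⟨
    bound (suc n) k m s t β̂                   ≤⟨ bound≤ ⟩
    length F                                  ∎)
    where open ≤-Reasoning


-- A family below the bound satisfies the inequality strictly and cannot attain equality, so the
-- structure is needed only for families that reach the bound.
bound-reached⇒ : ∀ {x y} {P : Set} → (y ≤ x → x ≤ y × (x ≡ y → P)) → x ≤ y × (x ≡ y → P)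
bound-reached⇒ {x} {y} h = case x <? y of λ where
  (yes x<y) → <⇒≤ x<y , λ e → contradiction x<y (<-irrefl e)
  (no x≮y)  → h (≮⇒≥ x≮y)

theorem1 : (k s t β : ℕ) → 3 ≤ k → 1 ≤ s → s ≤ t →
    Σ ℕ λ N → (n : ℕ) → N ≤ suc n →
    (β̂ : ℕ) → IsBetaHat k s β β̂ →
    (F : Family (suc n)) → Uniform k (members F) →
    UnionIntersecting s t (members F) → ℓ≥ (members F) (s + β) →
    (length (members F) ≤ bound (suc n) k (mfun k s β) s t β̂)
    × ((length (members F) ≡ bound (suc n) k (mfun k s β) s t β̂ →
    IsExtremal k s t (mfun k s β) (s + β̂) (members F))
    × (IsExtremal k s t (mfun k s β) (s + β̂) (members F) →
    length (members F) ≡ bound (suc n) k (mfun k s β) s t β̂))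
-- The threshold of `few-pairs-bound` for r = k - 3, one pair fewer than `mfun k s β`, and the
-- factor of the light members.
theorem1 k s t β 3≤k 1≤s s≤t = threshold (k ∸ 3) (mfun k s β ∸ 1) (lightFactor k s t) ,
  λ n large β̂ isβ̂ F uni ui ℓ →
    let upper , extremal = bound-reached⇒ (largeFamily k s t β 3≤k 1≤s s≤t n large β̂ isβ̂ (members F) (unique F) uni ui ℓ)
    in upper , extremal ,
       extremal⇒size k s t (mfun k s β) β̂ (≤-trans (s≤s z≤n) 3≤k) (≤-trans 1≤s s≤t) (mfun-β̂ 1≤s isβ̂) (unique F)
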